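{- Let $n\equiv 3\pmod 4$ be a positive integer and let $a$ be an indeterminate. Then \[ \sum_{k=0}^{(n-1)/2}\frac{(aq, q/a;q^2)_k\, (q^2;q^4)_k} {(aq^2, q^2/a;q^2)_k\, (q^4;q^4)_k}\, q^{2k}\equiv 0\pmod{\Phi_n(q)}. \]
   Context: Here $q$ and $a$ are indeterminates. For $x$ and a base $p$ (a power of $q$), $(x;p)_k=\prod_{j=0}^{k-1}(1-xp^j)$ and $(x_1,\dots,x_m;p)_k=(x_1;p)_k\cdots(x_m;p)_k$. $\Phi_n(q)$ is the $n$-th cyclotomic polynomial. For rational functions $A,B$ in $q$ and $a$ and a polynomial $P$, $A\equiv B\pmod{P}$ means that the numerator of the reduced form of $A-B$ is divisible by $P$ in the polynomial ring over $\mathbb{Z}$ in these variables (with denominators coprime to $P$). -}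

module Defs where

open import Data.Nat as ℕ using (ℕ; zero; suc)
open import Data.Nat.Divisibility using (_∣?_)
open import Data.Integer as ℤ using (ℤ)
open import Data.List using (List; []; _∷_; map)
open import Data.List.Relation.Unary.All using (All)
open import Data.Product using (Σ; _×_; _,_; proj₁; proj₂)
open import Data.Bool using (if_then_else_)
open import Relation.Nullary using (does)
open import Relation.Binary.PropositionalEquality using (_≡_)

record RawR : Set₁ where
  field
    C      : Set
    0# 1#  : C
    _+_ _*_ : C → C → C
    -_     : C → C
    IsZero : C → Set
  infixl 6 _+_
  infixl 7 _*_
  infix 8 -_

ℤR : RawR
ℤR = record
  { C = ℤ ; 0# = ℤ.+ 0 ; 1# = ℤ.+ 1 ; _+_ = ℤ._+_ ; _*_ = ℤ._*_ ; -_ = ℤ.-_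
  ; IsZero = λ x → x ≡ ℤ.+ 0 }

-- Univariate polynomials over R as coefficient lists (lowest degree first);
-- a polynomial is zero iff all its coefficients are zero.
PolyR : RawR → RawR
PolyR R = record
  { C = List C ; 0# = [] ; 1# = 1# ∷ [] ; _+_ = add ; _*_ = mul ; -_ = map -_
  ; IsZero = All IsZero }
  where
  open RawR R
  add : List C → List C → List C
  add [] ys = ys
  add (x ∷ xs) [] = x ∷ xs
  add (x ∷ xs) (y ∷ ys) = (x + y) ∷ add xs ys
  mul : List C → List C → List C
  mul [] ys = []
  mul (x ∷ xs) ys = add (map (x *_) ys) (0# ∷ mul xs ys)

-- ℤ[q,a] = (ℤ[q])[a]: outer list = coefficients of powers of a,
-- inner lists = polynomials in q.
ℤqa : RawR
ℤqa = PolyR (PolyR ℤR)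

open RawR ℤqa public renaming (C to Pol)

q : Pol
q = ((ℤ.+ 0) ∷ (ℤ.+ 1) ∷ []) ∷ []

a : Pol
a = [] ∷ ((ℤ.+ 1) ∷ []) ∷ []

infixl 6 _-_
_-_ : Pol → Pol → Pol
x - y = x + (- y)

_^_ : Pol → ℕ → Pol
x ^ zero = 1#
x ^ suc k = x * (x ^ k)

infix 4 _≈_ _∣_
_≈_ : Pol → Pol → Set
x ≈ y = IsZero (x - y)

_∣_ : Pol → Pol → Set
p ∣ x = Σ Pol λ c → x ≈ p * c

Coprime : Pol → Pol → Set
Coprime x y = (g : Pol) → g ∣ x → g ∣ y → g ∣ 1#

prodP : ℕ → (ℕ → Pol) → Pol
prodP zero f = 1#
prodP (suc k) f = prodP k f * f k

-- Φ is the family of cyclotomic polynomials: q^n - 1 = ∏_{d ∣ n} Φ_d (n ≥ 1).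
-- This determines Φ_n uniquely (ℤ[q,a] is an integral domain).
IsCyclotomic : (ℕ → Pol) → Set
IsCyclotomic Φ = (n : ℕ) → 1 ℕ.≤ n →
  prodP (suc n) (λ d → if does (d ∣? n) then (if does (d ℕ.≟ 0) then 1# else Φ d) else 1#)
    ≈ (q ^ n) - 1#

Frac : Set
Frac = Pol × Pol

num den : Frac → Pol
num = proj₁
den = proj₂

emb : Pol → Frac
emb x = x , 1#

f1 : Frac
f1 = emb 1#

infixl 6 _+ᶠ_ _-ᶠ_
infixl 7 _*ᶠ_ _/ᶠ_
_+ᶠ_ : Frac → Frac → Frac
(x , y) +ᶠ (z , w) = (x * w + z * y) , (y * w)

_*ᶠ_ : Frac → Frac → Frac
(x , y) *ᶠ (z , w) = (x * z) , (y * w)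

-ᶠ_ : Frac → Frac
-ᶠ (x , y) = (- x) , y

_-ᶠ_ : Frac → Frac → Frac
x -ᶠ y = x +ᶠ (-ᶠ y)

_/ᶠ_ : Frac → Frac → Frac
(x , y) /ᶠ (z , w) = (x * w) , (y * z)

_^ᶠ_ : Frac → ℕ → Frac
x ^ᶠ zero = f1
x ^ᶠ suc k = x *ᶠ (x ^ᶠ k)

prodF : ℕ → (ℕ → Frac) → Frac
prodF zero f = f1
prodF (suc k) f = prodF k f *ᶠ f k

sumF : ℕ → (ℕ → Frac) → Frac
sumF zero f = emb 0#
sumF (suc k) f = sumF k f +ᶠ f k

poch : Frac → Frac → ℕ → Frac
poch x p k = prodF k (λ j → f1 -ᶠ (x *ᶠ (p ^ᶠ j)))

-- A ≡ B (mod P): A - B = N / D with D coprime to P and P ∣ N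
-- (A - B = N/D is expressed by cross-multiplication).
infix 4 _≡_[mod_]
_≡_[mod_] : Frac → Frac → Pol → Set
A ≡ B [mod P ] =
  Σ Pol λ N → Σ Pol λ D →
    (num (A -ᶠ B) * D ≈ N * den (A -ᶠ B)) × Coprime D P × P ∣ N

qF aF : Frac
qF = emb q
aF = emb a

term : ℕ → Frac
term k =
  ( poch (aF *ᶠ qF) (qF ^ᶠ 2) k *ᶠ poch (qF /ᶠ aF) (qF ^ᶠ 2) k
      *ᶠ poch (qF ^ᶠ 2) (qF ^ᶠ 4) k *ᶠ (qF ^ᶠ (2 ℕ.* k)) )
  /ᶠ
  ( poch (aF *ᶠ (qF ^ᶠ 2)) (qF ^ᶠ 2) k *ᶠ poch ((qF ^ᶠ 2) /ᶠ aF) (qF ^ᶠ 2) k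
      *ᶠ poch (qF ^ᶠ 4) (qF ^ᶠ 4) k )

module Submission where

open import Defs using (RawR; ℤR; PolyR)
open import Algebra using (CommutativeRing; CommutativeMonoid; RawRing)
open import Algebra.Structures using (IsCommutativeRing)
open import Data.Bool using (if_then_else_)
open import Data.Empty using (⊥-elim)
open import Data.Integer as ℤ using (ℤ)
import Data.Integer.Properties as ℤₚ
open import Data.List using (List; []; _∷_; map)
open import Data.List.Relation.Unary.All as All using (All; []; _∷_)
open import Data.Maybe using (Maybe; just; nothing)
open import Data.Nat as ℕ using (ℕ; zero; suc; _∸_; _%_; _/_)
open import Data.Nat.Coprimality using (coprime-divisor) renaming (Coprime to Coprimeℕ)
import Data.Nat.Divisibility as ℕ∣
open import Data.Nat.DivMod using (m≡m%n+[m/n]*n; m*n/n≡m)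
open import Data.Nat.GCD
  using (gcd; gcd-GCD; gcd[m,n]∣m; gcd[m,n]∣n; gcd[m,n]≡0⇒n≡0; module Bézout)
import Data.Nat.Properties as ℕₚ
open import Data.Nat.Tactic.RingSolver using (solve-∀)
open import Data.Product using (∃; _×_; _,_; proj₁; proj₂)
open import Data.Sum using (_⊎_; inj₁; inj₂; [_,_]′)
open import Function using (_∘_; id)
open import Level using (0ℓ; _⊔_)
open import Relation.Binary.PropositionalEquality as ≡ using (_≡_)
open import Relation.Nullary using (Dec; yes; no; ¬_; does)
open import Relation.Nullary.Decidable using (dec-true; dec-false) renaming (map′ to mapDec)
open import Relation.Unary using (Decidable)

-- Put n = 2m + 1 with m odd and F(x) = (1 - ax)(a - x)(1 - x²)a. The k-th summand
-- is q^{2k} ∏_{j<k} F(q^{2j+1}) / ∏_{j<k} F(q^{2j+2}). If uv = 1, then F(u) = -u⁴ F(v);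
-- hence modulo q^n - 1 the factors F(q^{2j+2}), k ≤ j < m, become powers of q
-- times -F(q^{2i+1}), i < m - k. Over the common denominator ∏_{j<m} F(q^{2j+2}) the
-- k-th numerator is therefore (-1)^{m-k} G_k G_{m-k} times a power of q which does not
-- change under k ↦ m - k. As m is odd, the summands k and m - k cancel modulo q^n - 1.
--
-- For the denominator: Φ_n divides 1 + q^d + … + q^{n-d} for proper divisors d of n,
-- so the ideal (1 - q^e, Φ_n) contains a nonzero integer whenever n ∤ e. After a ↦ 1
-- every factor of the denominator has this property, and it is multiplicative.

-- The modulus q^n - 1 serves the reflection because it makes every power of `q` a unit, although
-- ℤ[q,a] itself has no inverses of `q`; divisibility by q^n - 1 then passes to Φ_n. The power of
-- `q` cleared from the k-th numerator is chosen symmetric in k and m - k, so that both partners are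
-- multiplied by the same unit. The fractions are formal pairs that are never reduced, so each is
-- compared by cross-multiplication with an explicit numerator and denominator. Coprimality is meant
-- in ℤ[q,a], where an integer could also be a common divisor; a nonzero integer in the ideal
-- (denominator, Φ_n, a - 1) is therefore not the end. A common divisor g also divides q^n - 1,
-- which is free of `a` and has constant term -1. The first property makes g free of `a`, the
-- integer in the ideal then makes it constant in `q`, and the constant term makes it a unit.

-- Folds take the bare operations, so that sums, products and powers in a ring are
-- convertible with those in its quotients.
fold : ∀ {a} {A : Set a} → (A → A → A) → A → ℕ → (ℕ → A) → A
fold _∙_ ε zero f = ε
fold _∙_ ε (suc n) f = fold _∙_ ε n f ∙ f n

-- Finite folds in commutative monoids

module Folds {c ℓ} (M : CommutativeMonoid c ℓ) where
  open CommutativeMonoid M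
  open import Relation.Binary.Reasoning.Setoid setoid
  open import Algebra.Properties.CommutativeSemigroup commutativeSemigroup using (interchange)

  ⨁ : ℕ → (ℕ → Carrier) → Carrier
  ⨁ = fold _∙_ ε

  fold-cong : ∀ n {f g} → (∀ i → i ℕ.< n → f i ≈ g i) → ⨁ n f ≈ ⨁ n g
  fold-cong zero f≈g = refl
  fold-cong (suc n) f≈g =
    ∙-cong (fold-cong n λ i i<n → f≈g i (ℕₚ.m<n⇒m<1+n i<n)) (f≈g n ℕₚ.≤-refl)

  fold-ε : ∀ n → ⨁ n (λ _ → ε) ≈ ε
  fold-ε zero = refl
  fold-ε (suc n) = trans (identityʳ _) (fold-ε n)

  fold-∙ : ∀ n f g → ⨁ n (λ i → f i ∙ g i) ≈ ⨁ n f ∙ ⨁ n g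
  fold-∙ zero f g = sym (identityˡ ε)
  fold-∙ (suc n) f g = trans (∙-congʳ (fold-∙ n f g)) (interchange _ _ _ _)

  fold-+ : ∀ m n f → ⨁ (m ℕ.+ n) f ≈ ⨁ m f ∙ ⨁ n (λ i → f (m ℕ.+ i))
  fold-+ m zero f rewrite ℕₚ.+-identityʳ m = sym (identityʳ _)
  fold-+ m (suc n) f rewrite ℕₚ.+-suc m n = trans (∙-congʳ (fold-+ m n f)) (assoc _ _ _)

  fold-head : ∀ n f → ⨁ (suc n) f ≈ f 0 ∙ ⨁ n (λ i → f (suc i))
  fold-head n f = trans (fold-+ 1 n f) (∙-congʳ (identityˡ _))

  fold-* : ∀ m n f → ⨁ (m ℕ.* n) (λ _ → f) ≈ ⨁ n (λ _ → ⨁ m (λ _ → f))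
  fold-* m zero f rewrite ℕₚ.*-zeroʳ m = refl
  fold-* m (suc n) f rewrite ℕₚ.*-suc m n = begin
    ⨁ (m ℕ.+ m ℕ.* n) (λ _ → f)                  ≈⟨ fold-+ m (m ℕ.* n) _ ⟩
    ⨁ m (λ _ → f) ∙ ⨁ (m ℕ.* n) (λ _ → f)        ≈⟨ comm _ _ ⟩
    ⨁ (m ℕ.* n) (λ _ → f) ∙ ⨁ m (λ _ → f)        ≈⟨ ∙-congʳ (fold-* m n f) ⟩
    ⨁ n (λ _ → ⨁ m (λ _ → f)) ∙ ⨁ m (λ _ → f)    ∎

  -- The last factor of the reversed tail is `f k`, which can be moved over to the initial segment.
  -- This completes a partial product of the `evens` to the common denominator.
  fold-reverseTail : ∀ k l f →
    ⨁ k f ∙ ⨁ l (λ i → f (k ℕ.+ (l ℕ.∸ suc i))) ≈ ⨁ (k ℕ.+ l) f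
  fold-reverseTail k zero f rewrite ℕₚ.+-identityʳ k = identityʳ _
  fold-reverseTail k (suc l) f = begin
    ⨁ k f ∙ (⨁ l (λ i → f (k ℕ.+ (l ℕ.∸ i))) ∙ f (k ℕ.+ (l ℕ.∸ l)))
      ≈⟨ ∙-congˡ (∙-cong (fold-cong l shift) (reflexive (≡.cong f last))) ⟩
    ⨁ k f ∙ (⨁ l (λ i → f (suc k ℕ.+ (l ℕ.∸ suc i))) ∙ f k)
      ≈⟨ ∙-congˡ (comm _ _) ⟩
    ⨁ k f ∙ (f k ∙ ⨁ l (λ i → f (suc k ℕ.+ (l ℕ.∸ suc i))))
      ≈⟨ sym (assoc _ _ _) ⟩
    ⨁ (suc k) f ∙ ⨁ l (λ i → f (suc k ℕ.+ (l ℕ.∸ suc i)))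
      ≈⟨ fold-reverseTail (suc k) l f ⟩
    ⨁ (suc k ℕ.+ l) f
      ≡⟨ ≡.cong (λ i → ⨁ i f) (≡.sym (ℕₚ.+-suc k l)) ⟩
    ⨁ (k ℕ.+ suc l) f ∎
    where
    last : k ℕ.+ (l ℕ.∸ l) ≡ k
    last rewrite ℕₚ.n∸n≡0 l = ℕₚ.+-identityʳ k
    shift : ∀ i → i ℕ.< l → f (k ℕ.+ (l ℕ.∸ i)) ≈ f (suc k ℕ.+ (l ℕ.∸ suc i))
    shift i i<l = reflexive (≡.cong f (≡.trans
      (≡.cong (k ℕ.+_) (ℕₚ.+-∸-assoc 1 i<l))
      (ℕₚ.+-suc k _)))

module FoldHomomorphism {c ℓ} (M : CommutativeMonoid c ℓ) where
  open CommutativeMonoid M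

  fold-homo : ∀ {a} {A : Set a} {_*_ : A → A → A} {e : A} (φ : A → Carrier) →
    (∀ x y → φ (x * y) ≈ φ x ∙ φ y) → φ e ≈ ε →
    ∀ n f → φ (fold _*_ e n f) ≈ fold _∙_ ε n (λ i → φ (f i))
  fold-homo φ φ-* φ-e zero f = φ-e
  fold-homo φ φ-* φ-e (suc n) f = trans (φ-* _ _) (∙-congʳ (fold-homo φ φ-* φ-e n f))

-- The ring solver of the standard library needs coefficients with a decidable
-- equality; here they are formal differences (m , n) = m - n with m = 0 or n = 0.
module IntegerCoefficients {c ℓ} (R : CommutativeRing c ℓ) where
  open CommutativeRing R hiding (zero)
  open import Algebra.Properties.Ring ring
  open import Algebra.Properties.AbelianGroup +-abelianGroup using (⁻¹-∙-comm)
  open import Algebra.Properties.Semiring.Mult.TCOptimised semiring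
    using (×-homo-+; ×1-homo-*; 1+×) renaming (_×_ to _⊗_)
  open import Algebra.Properties.CommutativeSemigroup +-commutativeSemigroup using (interchange)
  open import Algebra.Solver.Ring.AlmostCommutativeRing
    using (fromCommutativeRing; _-Raw-AlmostCommutative⟶_)
  open import Relation.Binary.Reasoning.Setoid setoid

  reduce : ℕ → ℕ → ℕ × ℕ
  reduce (suc m) (suc n) = reduce m n
  reduce m n = m , n

  coefficients : RawRing _ _
  coefficients = record
    { Carrier = ℕ × ℕ
    ; _≈_ = _≡_
    ; _+_ = λ (m , n) (m′ , n′) → reduce (m ℕ.+ m′) (n ℕ.+ n′)
    ; _*_ = λ (m , n) (m′ , n′) → reduce (m ℕ.* m′ ℕ.+ n ℕ.* n′) (m ℕ.* n′ ℕ.+ n ℕ.* m′)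
    ; -_ = λ (m , n) → n , m
    ; 0# = 0 , 0
    ; 1# = 1 , 0
    }

  -- The separate clause for n = 0 lets the coefficients 0 and 1 evaluate to `0#` and `1#` by
  -- computation.
  value : ℕ × ℕ → Carrier
  value (m , zero) = m ⊗ 1#
  value (m , suc n) = m ⊗ 1# - suc n ⊗ 1#

  value-difference : ∀ m n → value (m , n) ≈ m ⊗ 1# - n ⊗ 1#
  value-difference m zero = begin
    m ⊗ 1#         ≈⟨ sym (+-identityʳ _) ⟩
    m ⊗ 1# + 0#    ≈⟨ +-congˡ (sym -0#≈0#) ⟩
    m ⊗ 1# - 0#    ∎
  value-difference m (suc n) = refl

  value-reduce : ∀ m n → value (reduce m n) ≈ m ⊗ 1# - n ⊗ 1#
  value-reduce zero n = value-difference zero n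
  value-reduce (suc m) zero = value-difference (suc m) zero
  value-reduce (suc m) (suc n) = begin
    value (reduce m n)                       ≈⟨ value-reduce m n ⟩
    m ⊗ 1# - n ⊗ 1#                          ≈⟨ sym (+-identityˡ _) ⟩
    0# + (m ⊗ 1# - n ⊗ 1#)                   ≈⟨ +-congʳ (sym (-‿inverseʳ 1#)) ⟩
    (1# - 1#) + (m ⊗ 1# - n ⊗ 1#)            ≈⟨ interchange _ _ _ _ ⟩
    (1# + m ⊗ 1#) + (- 1# + - (n ⊗ 1#))      ≈⟨ +-cong (sym (1+× m 1#)) (⁻¹-∙-comm _ _) ⟩
    suc m ⊗ 1# - (1# + n ⊗ 1#)               ≈⟨ +-congˡ (-‿cong (sym (1+× n 1#))) ⟩
    suc m ⊗ 1# - suc n ⊗ 1#                  ∎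

  homomorphism : coefficients -Raw-AlmostCommutative⟶ fromCommutativeRing R
  homomorphism = record
    { ⟦_⟧ = value
    ; +-homo = +-homo
    ; *-homo = *-homo
    ; -‿homo = -‿homo
    ; 0-homo = refl
    ; 1-homo = refl
    }
    where
    +-homo : ∀ x y → value (RawRing._+_ coefficients x y) ≈ value x + value y
    +-homo (m , n) (m′ , n′) = begin
      value (reduce (m ℕ.+ m′) (n ℕ.+ n′))
        ≈⟨ value-reduce (m ℕ.+ m′) (n ℕ.+ n′) ⟩
      (m ℕ.+ m′) ⊗ 1# - (n ℕ.+ n′) ⊗ 1#
        ≈⟨ +-cong (×-homo-+ 1# m m′) (-‿cong (×-homo-+ 1# n n′)) ⟩
      (m ⊗ 1# + m′ ⊗ 1#) - (n ⊗ 1# + n′ ⊗ 1#)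
        ≈⟨ +-congˡ (sym (⁻¹-∙-comm _ _)) ⟩
      (m ⊗ 1# + m′ ⊗ 1#) + (- (n ⊗ 1#) + - (n′ ⊗ 1#))
        ≈⟨ interchange _ _ _ _ ⟩
      (m ⊗ 1# - n ⊗ 1#) + (m′ ⊗ 1# - n′ ⊗ 1#)
        ≈⟨ sym (+-cong (value-difference m n) (value-difference m′ n′)) ⟩
      value (m , n) + value (m′ , n′) ∎

    expand : ∀ x y z w → (x - y) * (z - w) ≈ (x * z + y * w) - (x * w + y * z)
    expand x y z w = begin
      (x - y) * (z - w)                                ≈⟨ distribʳ _ _ _ ⟩
      x * (z - w) + - y * (z - w)
        ≈⟨ +-cong (x[y-z]≈xy-xz x z w) (sym (-‿distribˡ-* y (z - w))) ⟩
      (x * z - x * w) + - (y * (z - w))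
        ≈⟨ +-congˡ (trans (-‿distribʳ-* y (z - w)) (*-congˡ (sym (⁻¹-∙-comm z (- w))))) ⟩
      (x * z - x * w) + y * (- z + - - w)              ≈⟨ +-congˡ (distribˡ _ _ _) ⟩
      (x * z - x * w) + (y * - z + y * - - w)
        ≈⟨ +-congˡ (+-cong (sym (-‿distribʳ-* y z)) (*-congˡ (-‿involutive w))) ⟩
      (x * z - x * w) + (- (y * z) + y * w)            ≈⟨ +-congˡ (+-comm _ _) ⟩
      (x * z - x * w) + (y * w - y * z)                ≈⟨ interchange _ _ _ _ ⟩
      (x * z + y * w) + (- (x * w) + - (y * z))        ≈⟨ +-congˡ (⁻¹-∙-comm _ _) ⟩
      (x * z + y * w) - (x * w + y * z)                ∎

    combine : ∀ m n m′ n′ → (m ℕ.* m′ ℕ.+ n ℕ.* n′) ⊗ 1# ≈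
      m ⊗ 1# * (m′ ⊗ 1#) + n ⊗ 1# * (n′ ⊗ 1#)
    combine m n m′ n′ = trans (×-homo-+ 1# (m ℕ.* m′) (n ℕ.* n′))
      (+-cong (×1-homo-* m m′) (×1-homo-* n n′))

    *-homo : ∀ x y → value (RawRing._*_ coefficients x y) ≈ value x * value y
    *-homo (m , n) (m′ , n′) = begin
      value (reduce (m ℕ.* m′ ℕ.+ n ℕ.* n′) (m ℕ.* n′ ℕ.+ n ℕ.* m′))
        ≈⟨ value-reduce (m ℕ.* m′ ℕ.+ n ℕ.* n′) (m ℕ.* n′ ℕ.+ n ℕ.* m′) ⟩
      (m ℕ.* m′ ℕ.+ n ℕ.* n′) ⊗ 1# - (m ℕ.* n′ ℕ.+ n ℕ.* m′) ⊗ 1#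
        ≈⟨ +-cong (combine m n m′ n′) (-‿cong (combine m n n′ m′)) ⟩
      (m ⊗ 1# * (m′ ⊗ 1#) + n ⊗ 1# * (n′ ⊗ 1#)) -
        (m ⊗ 1# * (n′ ⊗ 1#) + n ⊗ 1# * (m′ ⊗ 1#))
        ≈⟨ sym (expand _ _ _ _) ⟩
      (m ⊗ 1# - n ⊗ 1#) * (m′ ⊗ 1# - n′ ⊗ 1#)
        ≈⟨ sym (*-cong (value-difference m n) (value-difference m′ n′)) ⟩
      value (m , n) * value (m′ , n′) ∎

    -‿homo : ∀ x → value (RawRing.-_ coefficients x) ≈ - value x
    -‿homo (m , n) = begin
      value (n , m)                   ≈⟨ value-difference n m ⟩
      n ⊗ 1# - m ⊗ 1#                 ≈⟨ +-comm _ _ ⟩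
      - (m ⊗ 1#) + n ⊗ 1#             ≈⟨ +-congˡ (sym (-‿involutive _)) ⟩
      - (m ⊗ 1#) + - - (n ⊗ 1#)       ≈⟨ ⁻¹-∙-comm _ _ ⟩
      - (m ⊗ 1# - n ⊗ 1#)             ≈⟨ -‿cong (sym (value-difference m n)) ⟩
      - value (m , n)                 ∎

  _≟ᶜ_ : ∀ x y → Maybe (value x ≈ value y)
  (m , n) ≟ᶜ (m′ , n′) with m ℕ.≟ m′ | n ℕ.≟ n′
  ... | yes ≡.refl | yes ≡.refl = just refl
  ... | _ | _ = nothing

  open import Algebra.Solver.Ring coefficients (fromCommutativeRing R) homomorphism _≟ᶜ_ public
    using (solve; con; _:=_; _:+_; _:*_; :-_; _:-_; Polynomial)

  :1 : ∀ {n} → Polynomial n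
  :1 = con (1 , 0)

-- Polynomials over an integral domain with decidable zero

record IsDomain (R : RawR) : Set₁ where
  open RawR R
  field
    _≈_ : C → C → Set
    isCommutativeRing : IsCommutativeRing _≈_ _+_ _*_ -_ 0# 1#
    isZero⇒≈0 : ∀ {x} → IsZero x → x ≈ 0#
    ≈0⇒isZero : ∀ {x} → x ≈ 0# → IsZero x
    isZero? : Decidable IsZero
    nontrivial : ¬ (1# ≈ 0#)
    noZeroDivisors : ∀ {x y} → ¬ (x ≈ 0#) → ¬ (y ≈ 0#) → ¬ ((x * y) ≈ 0#)

  commutativeRing : CommutativeRing 0ℓ 0ℓ
  commutativeRing = record { isCommutativeRing = isCommutativeRing }

  _≈0? : Decidable (_≈ 0#)
  x ≈0? = mapDec isZero⇒≈0 ≈0⇒isZero (isZero? x)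

  open CommutativeRing commutativeRing hiding (_≈_; _+_; _*_; -_; 0#; 1#)
  open import Algebra.Properties.Ring ring using (x[y-z]≈xy-xz)
  open import Algebra.Properties.Group +-group using (x∙y⁻¹≈ε⇒x≈y; x≈y⇒x∙y⁻¹≈ε)

  isZero-difference⇒≈ : ∀ {x y} → IsZero (x + (- y)) → x ≈ y
  isZero-difference⇒≈ x-y≈0 = x∙y⁻¹≈ε⇒x≈y _ _ (isZero⇒≈0 x-y≈0)

  ≈⇒isZero-difference : ∀ {x y} → x ≈ y → IsZero (x + (- y))
  ≈⇒isZero-difference x≈y = ≈0⇒isZero (x≈y⇒x∙y⁻¹≈ε x≈y)

  -- `noZeroDivisors` can only refute; deciding whether y - z vanishes turns the refutation into an
  -- equality.
  *-cancelˡ-≉0 : ∀ {x y z} → ¬ (x ≈ 0#) → (x * y) ≈ (x * z) → y ≈ z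
  *-cancelˡ-≉0 {x} {y} {z} x≉0 xy≈xz with (y + (- z)) ≈0?
  ... | yes y-z≈0 = x∙y⁻¹≈ε⇒x≈y y z y-z≈0
  ... | no y-z≉0 = ⊥-elim (noZeroDivisors x≉0 y-z≉0
    (trans (x[y-z]≈xy-xz x y z) (x≈y⇒x∙y⁻¹≈ε xy≈xz)))

module Polynomials {R : RawR} (domain : IsDomain R) where
  open IsDomain domain hiding (_≈_)
  open CommutativeRing commutativeRing hiding (zero)
  open import Algebra.Properties.Ring ring using (-0#≈0#; x∙y⁻¹≈ε⇒x≈y; x≈y⇒x∙y⁻¹≈ε)
  open import Algebra.Properties.CommutativeSemigroup +-commutativeSemigroup
    using (interchange)
  open import Relation.Binary.Reasoning.Setoid setoid
  open RawR (PolyR R) using ()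
    renaming (0# to 0ₚ; 1# to 1ₚ; _+_ to _+ₚ_; _*_ to _*ₚ_; -_ to -ₚ_; IsZero to IsZeroₚ)

  Poly : Set
  Poly = List Carrier

  coeff : Poly → ℕ → Carrier
  coeff [] i = 0#
  coeff (x ∷ p) zero = x
  coeff (x ∷ p) (suc i) = coeff p i

  scale : Carrier → Poly → Poly
  scale x = map (x *_)

  coeff-+ : ∀ p r i → coeff (p +ₚ r) i ≈ coeff p i + coeff r i
  coeff-+ [] r i = sym (+-identityˡ _)
  coeff-+ (x ∷ p) [] i = sym (+-identityʳ _)
  coeff-+ (x ∷ p) (y ∷ r) zero = refl
  coeff-+ (x ∷ p) (y ∷ r) (suc i) = coeff-+ p r i

  coeff-neg : ∀ p i → coeff (-ₚ p) i ≈ - coeff p i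
  coeff-neg [] i = sym -0#≈0#
  coeff-neg (x ∷ p) zero = refl
  coeff-neg (x ∷ p) (suc i) = coeff-neg p i

  coeff-scale : ∀ x p i → coeff (scale x p) i ≈ x * coeff p i
  coeff-scale x [] i = sym (zeroʳ x)
  coeff-scale x (y ∷ p) zero = refl
  coeff-scale x (y ∷ p) (suc i) = coeff-scale x p i

  infix 4 _≈ₚ_
  -- Comparing coefficients ignores trailing zeros, as `IsZero` does. The record wrapper lets both
  -- polynomials be inferred from a proof.
  record _≈ₚ_ (p r : Poly) : Set where
    constructor coeffwise
    field coeffs : ∀ i → coeff p i ≈ coeff r i
  open _≈ₚ_

  isZero⇒≈[] : ∀ {p} → IsZeroₚ p → p ≈ₚ []
  isZero⇒≈[] [] = coeffwise λ i → refl
  isZero⇒≈[] (x≈0 ∷ p≈0) = coeffwise λ where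
    zero → isZero⇒≈0 x≈0
    (suc i) → coeffs (isZero⇒≈[] p≈0) i

  ≈[]⇒isZero : ∀ {p} → p ≈ₚ [] → IsZeroₚ p
  ≈[]⇒isZero {[]} p≈0 = []
  ≈[]⇒isZero {x ∷ p} p≈0 =
    ≈0⇒isZero (coeffs p≈0 zero) ∷ ≈[]⇒isZero (coeffwise λ i → coeffs p≈0 (suc i))

  coeff-difference : ∀ p r i → coeff (p +ₚ (-ₚ r)) i ≈ coeff p i - coeff r i
  coeff-difference p r i = trans (coeff-+ p (-ₚ r) i) (+-congˡ (coeff-neg r i))

  ≈ₚ-refl : ∀ {p} → p ≈ₚ p
  ≈ₚ-refl = coeffwise λ i → refl

  ≈ₚ-sym : ∀ {p r} → p ≈ₚ r → r ≈ₚ p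
  ≈ₚ-sym p≈r = coeffwise λ i → sym (coeffs p≈r i)

  ≈ₚ-trans : ∀ {p r s} → p ≈ₚ r → r ≈ₚ s → p ≈ₚ s
  ≈ₚ-trans p≈r r≈s = coeffwise λ i → trans (coeffs p≈r i) (coeffs r≈s i)

  infixr 2 _≈ₚ⟨_⟩_
  infix 3 _≈ₚ∎
  _≈ₚ⟨_⟩_ : ∀ p {r s} → p ≈ₚ r → r ≈ₚ s → p ≈ₚ s
  p ≈ₚ⟨ p≈r ⟩ r≈s = ≈ₚ-trans p≈r r≈s
  _≈ₚ∎ : ∀ p → p ≈ₚ p
  p ≈ₚ∎ = ≈ₚ-refl

  +-congₚ : ∀ {p p′ r r′} → p ≈ₚ p′ → r ≈ₚ r′ → p +ₚ r ≈ₚ p′ +ₚ r′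
  +-congₚ {p} {p′} {r} {r′} p≈p′ r≈r′ = coeffwise λ i →
    trans (coeff-+ p r i) (trans (+-cong (coeffs p≈p′ i) (coeffs r≈r′ i)) (sym (coeff-+ p′ r′ i)))

  +-commₚ : ∀ p r → p +ₚ r ≈ₚ r +ₚ p
  +-commₚ p r = coeffwise λ i →
    trans (coeff-+ p r i) (trans (+-comm _ _) (sym (coeff-+ r p i)))

  +-assocₚ : ∀ p r s → (p +ₚ r) +ₚ s ≈ₚ p +ₚ (r +ₚ s)
  +-assocₚ p r s = coeffwise λ i → begin
    coeff ((p +ₚ r) +ₚ s) i               ≈⟨ coeff-+ (p +ₚ r) s i ⟩
    coeff (p +ₚ r) i + coeff s i          ≈⟨ +-congʳ (coeff-+ p r i) ⟩
    (coeff p i + coeff r i) + coeff s i   ≈⟨ +-assoc _ _ _ ⟩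
    coeff p i + (coeff r i + coeff s i)   ≈⟨ +-congˡ (sym (coeff-+ r s i)) ⟩
    coeff p i + coeff (r +ₚ s) i          ≈⟨ sym (coeff-+ p (r +ₚ s) i) ⟩
    coeff (p +ₚ (r +ₚ s)) i               ∎

  +-identityʳₚ : ∀ p → p +ₚ [] ≈ₚ p
  +-identityʳₚ p = +-commₚ p []

  +-interchangeₚ : ∀ p r s t → (p +ₚ r) +ₚ (s +ₚ t) ≈ₚ (p +ₚ s) +ₚ (r +ₚ t)
  +-interchangeₚ p r s t = coeffwise λ i → begin
    coeff ((p +ₚ r) +ₚ (s +ₚ t)) i                          ≈⟨ expand p r s t i ⟩
    (coeff p i + coeff r i) + (coeff s i + coeff t i)       ≈⟨ interchange _ _ _ _ ⟩
    (coeff p i + coeff s i) + (coeff r i + coeff t i)       ≈⟨ sym (expand p s r t i) ⟩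
    coeff ((p +ₚ s) +ₚ (r +ₚ t)) i                          ∎
    where
    expand : ∀ p r s t i → coeff ((p +ₚ r) +ₚ (s +ₚ t)) i ≈
      (coeff p i + coeff r i) + (coeff s i + coeff t i)
    expand p r s t i = trans (coeff-+ (p +ₚ r) (s +ₚ t) i)
      (+-cong (coeff-+ p r i) (coeff-+ s t i))

  neg-congₚ : ∀ {p r} → p ≈ₚ r → -ₚ p ≈ₚ -ₚ r
  neg-congₚ {p} {r} p≈r = coeffwise λ i →
    trans (coeff-neg p i) (trans (-‿cong (coeffs p≈r i)) (sym (coeff-neg r i)))

  neg-inverseʳₚ : ∀ p → p +ₚ (-ₚ p) ≈ₚ []
  neg-inverseʳₚ p = coeffwise λ i → trans (coeff-difference p p i) (-‿inverseʳ _)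

  shift : Poly → Poly
  shift p = 0# ∷ p

  ∷-cong : ∀ {x y p r} → x ≈ y → p ≈ₚ r → x ∷ p ≈ₚ y ∷ r
  ∷-cong x≈y p≈r = coeffwise λ where
    zero → x≈y
    (suc i) → coeffs p≈r i

  shift-+ : ∀ p r → shift (p +ₚ r) ≈ₚ shift p +ₚ shift r
  shift-+ p r = ∷-cong (sym (+-identityʳ 0#)) ≈ₚ-refl

  shift-[] : shift [] ≈ₚ []
  shift-[] = coeffwise λ where
    zero → refl
    (suc i) → refl

  scale-cong : ∀ {x y p r} → x ≈ y → p ≈ₚ r → scale x p ≈ₚ scale y r
  scale-cong {x} {y} {p} {r} x≈y p≈r = coeffwise λ i →
    trans (coeff-scale x p i) (trans (*-cong x≈y (coeffs p≈r i)) (sym (coeff-scale y r i)))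

  scale-+ : ∀ x p r → scale x (p +ₚ r) ≈ₚ scale x p +ₚ scale x r
  scale-+ x p r = coeffwise λ i → begin
    coeff (scale x (p +ₚ r)) i                     ≈⟨ coeff-scale x (p +ₚ r) i ⟩
    x * coeff (p +ₚ r) i                           ≈⟨ *-congˡ (coeff-+ p r i) ⟩
    x * (coeff p i + coeff r i)                    ≈⟨ distribˡ _ _ _ ⟩
    x * coeff p i + x * coeff r i
      ≈⟨ sym (+-cong (coeff-scale x p i) (coeff-scale x r i)) ⟩
    coeff (scale x p) i + coeff (scale x r) i      ≈⟨ sym (coeff-+ (scale x p) (scale x r) i) ⟩
    coeff (scale x p +ₚ scale x r) i               ∎

  scale-0 : ∀ p → scale 0# p ≈ₚ []
  scale-0 p = coeffwise λ i → trans (coeff-scale 0# p i) (zeroˡ _)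

  scale-1 : ∀ p → scale 1# p ≈ₚ p
  scale-1 p = coeffwise λ i → trans (coeff-scale 1# p i) (*-identityˡ _)

  scale-* : ∀ x y p → scale x (scale y p) ≈ₚ scale (x * y) p
  scale-* x y p = coeffwise λ i → begin
    coeff (scale x (scale y p)) i   ≈⟨ coeff-scale x (scale y p) i ⟩
    x * coeff (scale y p) i         ≈⟨ *-congˡ (coeff-scale y p i) ⟩
    x * (y * coeff p i)             ≈⟨ sym (*-assoc _ _ _) ⟩
    x * y * coeff p i               ≈⟨ sym (coeff-scale (x * y) p i) ⟩
    coeff (scale (x * y) p) i       ∎

  scale-shift : ∀ x p → scale x (shift p) ≈ₚ shift (scale x p)
  scale-shift x p = ∷-cong (zeroʳ x) ≈ₚ-refl

  *-congʳₚ : ∀ p {r s} → r ≈ₚ s → p *ₚ r ≈ₚ p *ₚ s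
  *-congʳₚ [] r≈s = ≈ₚ-refl
  *-congʳₚ (x ∷ p) r≈s = +-congₚ (scale-cong refl r≈s) (∷-cong refl (*-congʳₚ p r≈s))

  *-zeroʳₚ : ∀ p → p *ₚ [] ≈ₚ []
  *-zeroʳₚ [] = ≈ₚ-refl
  *-zeroʳₚ (x ∷ p) = ≈ₚ-trans (∷-cong refl (*-zeroʳₚ p)) shift-[]

  *-distribˡₚ : ∀ p r s → p *ₚ (r +ₚ s) ≈ₚ (p *ₚ r) +ₚ (p *ₚ s)
  *-distribˡₚ [] r s = ≈ₚ-refl
  *-distribˡₚ (x ∷ p) r s =
    scale x (r +ₚ s) +ₚ shift (p *ₚ (r +ₚ s))
      ≈ₚ⟨ +-congₚ (scale-+ x r s) (∷-cong refl (*-distribˡₚ p r s)) ⟩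
    (scale x r +ₚ scale x s) +ₚ shift ((p *ₚ r) +ₚ (p *ₚ s))
      ≈ₚ⟨ +-congₚ ≈ₚ-refl (shift-+ (p *ₚ r) (p *ₚ s)) ⟩
    (scale x r +ₚ scale x s) +ₚ (shift (p *ₚ r) +ₚ shift (p *ₚ s))
      ≈ₚ⟨ +-interchangeₚ (scale x r) (scale x s) (shift (p *ₚ r)) (shift (p *ₚ s)) ⟩
    (scale x r +ₚ shift (p *ₚ r)) +ₚ (scale x s +ₚ shift (p *ₚ s)) ≈ₚ∎

  -- The product recurses on its left argument; this mirrored recursion is the induction step of
  -- commutativity.
  *-∷ʳ : ∀ p y r → p *ₚ (y ∷ r) ≈ₚ scale y p +ₚ shift (p *ₚ r)
  *-∷ʳ [] y r = ≈ₚ-sym shift-[]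
  *-∷ʳ (x ∷ p) y r = ∷-cong (+-congʳ (*-comm x y))
    (scale x r +ₚ (p *ₚ (y ∷ r))
      ≈ₚ⟨ +-congₚ ≈ₚ-refl (*-∷ʳ p y r) ⟩
    scale x r +ₚ (scale y p +ₚ shift (p *ₚ r))
      ≈ₚ⟨ ≈ₚ-sym (+-assocₚ (scale x r) (scale y p) (shift (p *ₚ r))) ⟩
    (scale x r +ₚ scale y p) +ₚ shift (p *ₚ r)
      ≈ₚ⟨ +-congₚ (+-commₚ (scale x r) (scale y p)) ≈ₚ-refl ⟩
    (scale y p +ₚ scale x r) +ₚ shift (p *ₚ r)
      ≈ₚ⟨ +-assocₚ (scale y p) (scale x r) (shift (p *ₚ r)) ⟩
    scale y p +ₚ (scale x r +ₚ shift (p *ₚ r)) ≈ₚ∎)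

  *-commₚ : ∀ p r → p *ₚ r ≈ₚ r *ₚ p
  *-commₚ [] r = ≈ₚ-sym (*-zeroʳₚ r)
  *-commₚ (x ∷ p) r =
    scale x r +ₚ shift (p *ₚ r)   ≈ₚ⟨ +-congₚ ≈ₚ-refl (∷-cong refl (*-commₚ p r)) ⟩
    scale x r +ₚ shift (r *ₚ p)   ≈ₚ⟨ ≈ₚ-sym (*-∷ʳ r x p) ⟩
    r *ₚ (x ∷ p)                  ≈ₚ∎

  *-congₚ : ∀ {p p′ r r′} → p ≈ₚ p′ → r ≈ₚ r′ → p *ₚ r ≈ₚ p′ *ₚ r′
  *-congₚ {p} {p′} {r} {r′} p≈p′ r≈r′ =
    p *ₚ r     ≈ₚ⟨ *-congʳₚ p r≈r′ ⟩
    p *ₚ r′    ≈ₚ⟨ *-commₚ p r′ ⟩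
    r′ *ₚ p    ≈ₚ⟨ *-congʳₚ r′ p≈p′ ⟩
    r′ *ₚ p′   ≈ₚ⟨ *-commₚ r′ p′ ⟩
    p′ *ₚ r′   ≈ₚ∎

  *-distribʳₚ : ∀ p r s → (r +ₚ s) *ₚ p ≈ₚ (r *ₚ p) +ₚ (s *ₚ p)
  *-distribʳₚ p r s =
    (r +ₚ s) *ₚ p            ≈ₚ⟨ *-commₚ (r +ₚ s) p ⟩
    p *ₚ (r +ₚ s)            ≈ₚ⟨ *-distribˡₚ p r s ⟩
    (p *ₚ r) +ₚ (p *ₚ s)     ≈ₚ⟨ +-congₚ (*-commₚ p r) (*-commₚ p s) ⟩
    (r *ₚ p) +ₚ (s *ₚ p)     ≈ₚ∎

  scale-*ₚ : ∀ x p r → scale x p *ₚ r ≈ₚ scale x (p *ₚ r)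
  scale-*ₚ x [] r = ≈ₚ-refl
  scale-*ₚ x (y ∷ p) r =
    scale (x * y) r +ₚ shift (scale x p *ₚ r)
      ≈ₚ⟨ +-congₚ (≈ₚ-sym (scale-* x y r)) (∷-cong refl (scale-*ₚ x p r)) ⟩
    scale x (scale y r) +ₚ shift (scale x (p *ₚ r))
      ≈ₚ⟨ +-congₚ ≈ₚ-refl (≈ₚ-sym (scale-shift x (p *ₚ r))) ⟩
    scale x (scale y r) +ₚ scale x (shift (p *ₚ r))
      ≈ₚ⟨ ≈ₚ-sym (scale-+ x (scale y r) (shift (p *ₚ r))) ⟩
    scale x (scale y r +ₚ shift (p *ₚ r)) ≈ₚ∎

  shift-*ₚ : ∀ p r → shift p *ₚ r ≈ₚ shift (p *ₚ r)
  shift-*ₚ p r = +-congₚ (scale-0 r) ≈ₚ-refl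

  *-assocₚ : ∀ p r s → (p *ₚ r) *ₚ s ≈ₚ p *ₚ (r *ₚ s)
  *-assocₚ [] r s = ≈ₚ-refl
  *-assocₚ (x ∷ p) r s =
    (scale x r +ₚ shift (p *ₚ r)) *ₚ s
      ≈ₚ⟨ *-distribʳₚ s (scale x r) (shift (p *ₚ r)) ⟩
    (scale x r *ₚ s) +ₚ (shift (p *ₚ r) *ₚ s)
      ≈ₚ⟨ +-congₚ (scale-*ₚ x r s) (shift-*ₚ (p *ₚ r) s) ⟩
    scale x (r *ₚ s) +ₚ shift ((p *ₚ r) *ₚ s)
      ≈ₚ⟨ +-congₚ ≈ₚ-refl (∷-cong refl (*-assocₚ p r s)) ⟩
    scale x (r *ₚ s) +ₚ shift (p *ₚ (r *ₚ s)) ≈ₚ∎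

  *-identityˡₚ : ∀ p → 1ₚ *ₚ p ≈ₚ p
  *-identityˡₚ p =
    scale 1# p +ₚ shift []   ≈ₚ⟨ +-congₚ (scale-1 p) shift-[] ⟩
    p +ₚ []                  ≈ₚ⟨ +-identityʳₚ p ⟩
    p                        ≈ₚ∎

  isCommutativeRingₚ : IsCommutativeRing _≈ₚ_ _+ₚ_ _*ₚ_ -ₚ_ 0ₚ 1ₚ
  isCommutativeRingₚ = record
    { isRing = record
      { +-isAbelianGroup = record
        { isGroup = record
          { isMonoid = record
            { isSemigroup = record
              { isMagma = record
                { isEquivalence = record { refl = ≈ₚ-refl ; sym = ≈ₚ-sym ; trans = ≈ₚ-trans }
                ; ∙-cong = +-congₚ
                }
              ; assoc = +-assocₚ
              }
            ; identity = (λ p → ≈ₚ-refl) , +-identityʳₚ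
            }
          ; inverse = (λ p → ≈ₚ-trans (+-commₚ (-ₚ p) p) (neg-inverseʳₚ p)) , neg-inverseʳₚ
          ; ⁻¹-cong = neg-congₚ
          }
        ; comm = +-commₚ
        }
      ; *-cong = *-congₚ
      ; *-assoc = *-assocₚ
      ; *-identity = *-identityˡₚ , λ p → ≈ₚ-trans (*-commₚ p 1ₚ) (*-identityˡₚ p)
      ; distrib = *-distribˡₚ , *-distribʳₚ
      }
    ; *-comm = *-commₚ
    }

  record Leading (p : Poly) (d : ℕ) : Set where
    field
      leading≉0 : ¬ coeff p d ≈ 0#
      above≈0 : ∀ i → d ℕ.< i → coeff p i ≈ 0#
  open Leading

  leading : ∀ p → p ≈ₚ [] ⊎ ∃ (Leading p)
  leading [] = inj₁ ≈ₚ-refl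
  leading (x ∷ p) with leading p | x ≈0?
  ... | inj₂ (d , lead) | _ = inj₂ (suc d , record
    { leading≉0 = leading≉0 lead
    ; above≈0 = λ { (suc i) (ℕ.s≤s d<i) → above≈0 lead i d<i }
    })
  ... | inj₁ p≈0 | yes x≈0 = inj₁ (≈ₚ-trans (∷-cong x≈0 p≈0) shift-[])
  ... | inj₁ p≈0 | no x≉0 = inj₂ (0 , record
    { leading≉0 = x≉0
    ; above≈0 = λ { (suc i) _ → coeffs p≈0 i }
    })

  coeff-*-∷ : ∀ x p r i → coeff ((x ∷ p) *ₚ r) (suc i) ≈ x * coeff r (suc i) + coeff (p *ₚ r) i
  coeff-*-∷ x p r i = trans (coeff-+ (scale x r) (shift (p *ₚ r)) (suc i))
    (+-congʳ (coeff-scale x r (suc i)))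

  coeff-const-* : ∀ x p r → p ≈ₚ [] → ∀ i → coeff ((x ∷ p) *ₚ r) i ≈ x * coeff r i
  coeff-const-* x p r p≈0 i = begin
    coeff (scale x r +ₚ shift (p *ₚ r)) i
      ≈⟨ coeffs (+-congₚ (≈ₚ-refl {scale x r})
           (≈ₚ-trans (∷-cong refl (*-congₚ p≈0 (≈ₚ-refl {r}))) shift-[])) i ⟩
    coeff (scale x r +ₚ []) i    ≈⟨ coeffs (+-identityʳₚ (scale x r)) i ⟩
    coeff (scale x r) i          ≈⟨ coeff-scale x r i ⟩
    x * coeff r i                ∎

  -- The head `x` contributes x times `r`, which vanishes above degree e; as long as d is positive,
  -- the top coefficient comes from the tail of `p` alone.
  above-* : ∀ p r d e → (∀ i → d ℕ.< i → coeff p i ≈ 0#) → (∀ i → e ℕ.< i → coeff r i ≈ 0#) →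
    (coeff (p *ₚ r) (d ℕ.+ e) ≈ coeff p d * coeff r e) ×
    (∀ i → d ℕ.+ e ℕ.< i → coeff (p *ₚ r) i ≈ 0#)
  above-* [] r d e p>d r>e = sym (zeroˡ _) , λ i _ → refl
  above-* (x ∷ p) r zero e p>d r>e =
    coeff-const-* x p r p≈0 e ,
    λ i e<i → trans (coeff-const-* x p r p≈0 i) (trans (*-congˡ (r>e i e<i)) (zeroʳ x))
    where
    p≈0 : p ≈ₚ []
    p≈0 = coeffwise λ i → p>d (suc i) (ℕ.s≤s ℕ.z≤n)
  above-* (x ∷ p) r (suc d) e p>d r>e with above-* p r d e (λ i d<i → p>d (suc i) (ℕ.s≤s d<i)) r>e
  ... | top , above = (begin
      coeff ((x ∷ p) *ₚ r) (suc (d ℕ.+ e))                  ≈⟨ coeff-*-∷ x p r (d ℕ.+ e) ⟩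
      x * coeff r (suc (d ℕ.+ e)) + coeff (p *ₚ r) (d ℕ.+ e)
        ≈⟨ drop (d ℕ.+ e) (ℕ.s≤s (ℕₚ.m≤n+m e d)) ⟩
      coeff (p *ₚ r) (d ℕ.+ e)                               ≈⟨ top ⟩
      coeff p d * coeff r e                                  ∎) ,
    λ { (suc i) (ℕ.s≤s d+e<i) → trans (coeff-*-∷ x p r i)
          (trans (drop i (ℕ.s≤s (ℕₚ.≤-trans (ℕₚ.m≤n+m e d) (ℕₚ.<⇒≤ d+e<i))))
            (above i d+e<i)) }
    where
    drop : ∀ i → e ℕ.< suc i → x * coeff r (suc i) + coeff (p *ₚ r) i ≈ coeff (p *ₚ r) i
    drop i e<i = trans (+-congʳ (trans (*-congˡ (r>e (suc i) e<i)) (zeroʳ x))) (+-identityˡ _)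

  leading-* : ∀ {p r d e} → Leading p d → Leading r e → Leading (p *ₚ r) (d ℕ.+ e)
  leading-* {p} {r} {d} {e} lead-p lead-r = record
    { leading≉0 = λ top≈0 → noZeroDivisors (leading≉0 lead-p) (leading≉0 lead-r)
        (trans (sym (proj₁ product)) top≈0)
    ; above≈0 = proj₂ product
    }
    where
    product = above-* p r d e (above≈0 lead-p) (above≈0 lead-r)

  Leading⇒≉0 : ∀ {p d} → Leading p d → ¬ p ≈ₚ []
  Leading⇒≉0 {d = d} lead p≈0 = leading≉0 lead (coeffs p≈0 d)

  isDomainₚ : IsDomain (PolyR R)
  isDomainₚ = record
    { _≈_ = _≈ₚ_
    ; isCommutativeRing = isCommutativeRingₚ
    ; isZero⇒≈0 = isZero⇒≈[]
    ; ≈0⇒isZero = ≈[]⇒isZero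
    ; isZero? = All.all? isZero?
    ; nontrivial = λ 1≈0 → nontrivial (coeffs 1≈0 0)
    ; noZeroDivisors = noZeroDivisorsₚ
    }
    where
    noZeroDivisorsₚ : ∀ {p r} → ¬ p ≈ₚ 0ₚ → ¬ r ≈ₚ 0ₚ → ¬ p *ₚ r ≈ₚ 0ₚ
    noZeroDivisorsₚ {p} {r} p≉0 r≉0 pr≈0 with leading p | leading r
    ... | inj₁ p≈0 | _ = p≉0 p≈0
    ... | inj₂ _ | inj₁ r≈0 = r≉0 r≈0
    ... | inj₂ (d , lead-p) | inj₂ (e , lead-r) = Leading⇒≉0 (leading-* lead-p lead-r) pr≈0

  -- Degrees add over a domain. The lemma serves twice, to remove `a` and then `q` from a common
  -- divisor.
  factor-const : ∀ {p r x} → p *ₚ r ≈ₚ x ∷ [] → ¬ x ≈ 0# → ∃ λ y → p ≈ₚ y ∷ []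
  factor-const {p} {r} {x} pr≈x x≉0 with leading p | leading r
  ... | inj₁ p≈0 | _ = ⊥-elim (x≉0 (trans (sym (coeffs pr≈x 0))
          (coeffs (*-congₚ p≈0 (≈ₚ-refl {r})) 0)))
  ... | inj₂ _ | inj₁ r≈0 = ⊥-elim (x≉0 (trans (sym (coeffs pr≈x 0))
          (coeffs (≈ₚ-trans (*-congₚ (≈ₚ-refl {p}) r≈0) (*-zeroʳₚ p)) 0)))
  ... | inj₂ (suc d , lead-p) | inj₂ (e , lead-r) =
    ⊥-elim (leading≉0 (leading-* lead-p lead-r) (coeffs pr≈x (suc (d ℕ.+ e))))
  ... | inj₂ (zero , lead-p) | inj₂ (e , lead-r) = coeff p 0 , (coeffwise λ where
    zero → refl
    (suc i) → above≈0 lead-p (suc i) (ℕ.s≤s ℕ.z≤n))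

  const-+ : ∀ x y → (x + y) ∷ [] ≈ₚ (x ∷ []) +ₚ (y ∷ [])
  const-+ x y = ≈ₚ-refl

  const-* : ∀ x y → (x * y) ∷ [] ≈ₚ (x ∷ []) *ₚ (y ∷ [])
  const-* x y = (∷-cong (sym (+-identityʳ _)) ≈ₚ-refl)

  const-cong : ∀ {x y} → x ≈ y → x ∷ [] ≈ₚ y ∷ []
  const-cong x≈y = (∷-cong x≈y ≈ₚ-refl)

  eval : Carrier → Poly → Carrier
  eval x [] = 0#
  eval x (y ∷ p) = y + x * eval x p

  module _ (x : Carrier) where
    eval-+ : ∀ p r → eval x (p +ₚ r) ≈ eval x p + eval x r
    eval-+ [] r = sym (+-identityˡ _)
    eval-+ (y ∷ p) [] = sym (+-identityʳ _)
    eval-+ (y ∷ p) (z ∷ r) = begin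
      (y + z) + x * eval x (p +ₚ r)                    ≈⟨ +-congˡ (*-congˡ (eval-+ p r)) ⟩
      (y + z) + x * (eval x p + eval x r)              ≈⟨ +-congˡ (distribˡ _ _ _) ⟩
      (y + z) + (x * eval x p + x * eval x r)          ≈⟨ interchange _ _ _ _ ⟩
      (y + x * eval x p) + (z + x * eval x r)          ∎

    eval-scale : ∀ y p → eval x (scale y p) ≈ y * eval x p
    eval-scale y [] = sym (zeroʳ y)
    eval-scale y (z ∷ p) = begin
      y * z + x * eval x (scale y p)      ≈⟨ +-congˡ (*-congˡ (eval-scale y p)) ⟩
      y * z + x * (y * eval x p)          ≈⟨ +-congˡ (x*yz≈y*xz x y _) ⟩
      y * z + y * (x * eval x p)          ≈⟨ sym (distribˡ _ _ _) ⟩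
      y * (z + x * eval x p)              ∎
      where
      open import Algebra.Properties.CommutativeSemigroup *-commutativeSemigroup
        using () renaming (x∙yz≈y∙xz to x*yz≈y*xz)

    eval-* : ∀ p r → eval x (p *ₚ r) ≈ eval x p * eval x r
    eval-* [] r = sym (zeroˡ _)
    eval-* (y ∷ p) r = begin
      eval x (scale y r +ₚ shift (p *ₚ r))              ≈⟨ eval-+ (scale y r) (shift (p *ₚ r)) ⟩
      eval x (scale y r) + (0# + x * eval x (p *ₚ r))
        ≈⟨ +-cong (eval-scale y r) (trans (+-identityˡ _) (*-congˡ (eval-* p r))) ⟩
      y * eval x r + x * (eval x p * eval x r)          ≈⟨ +-congˡ (sym (*-assoc _ _ _)) ⟩
      y * eval x r + x * eval x p * eval x r            ≈⟨ sym (distribʳ _ _ _) ⟩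
      (y + x * eval x p) * eval x r                     ∎

    eval-0 : ∀ {p} → p ≈ₚ [] → eval x p ≈ 0#
    eval-0 {[]} p≈0 = refl
    eval-0 {y ∷ p} p≈0 = trans
      (+-cong (coeffs p≈0 0) (trans (*-congˡ (eval-0 {p} (coeffwise λ i → coeffs p≈0 (suc i)))) (zeroʳ x)))
      (+-identityˡ 0#)

    eval-const : ∀ y → eval x (y ∷ []) ≈ y
    eval-const y = trans (+-congˡ (zeroʳ x)) (+-identityʳ y)

    eval-1 : eval x 1ₚ ≈ 1#
    eval-1 = eval-const 1#

    -- Equal polynomials may be lists of different lengths; their difference leaves a single list to
    -- recurse on.
    eval-cong : ∀ {p r} → p ≈ₚ r → eval x p ≈ eval x r
    eval-cong {p} {r} p≈r = x∙y⁻¹≈ε⇒x≈y _ _ (begin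
      eval x p - eval x r            ≈⟨ +-congˡ (sym (eval-neg r)) ⟩
      eval x p + eval x (-ₚ r)       ≈⟨ sym (eval-+ p (-ₚ r)) ⟩
      eval x (p +ₚ (-ₚ r))           ≈⟨ eval-0 {p +ₚ (-ₚ r)} (≈ₚ-trans (+-congₚ p≈r ≈ₚ-refl) (neg-inverseʳₚ r)) ⟩
      0#                             ∎)
      where
      open import Algebra.Properties.Group +-group using (inverseʳ-unique)
      eval-neg : ∀ p → eval x (-ₚ p) ≈ - eval x p
      eval-neg p = inverseʳ-unique _ _
        (trans (sym (eval-+ p (-ₚ p))) (eval-0 {p +ₚ (-ₚ p)} (neg-inverseʳₚ p)))

-- Powers, signs and finite sums in commutative rings

module RingFolds {c ℓ} (R : CommutativeRing c ℓ) where
  open CommutativeRing R hiding (zero)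
  open import Relation.Binary.Reasoning.Setoid setoid
  open IntegerCoefficients R
  module Sum = Folds +-commutativeMonoid
  module Product = Folds *-commutativeMonoid

  ∑ ∏ : ℕ → (ℕ → Carrier) → Carrier
  ∑ = fold _+_ 0#
  ∏ = fold _*_ 1#

  infixr 8 _^^_
  _^^_ : Carrier → ℕ → Carrier
  x ^^ n = ∏ n (λ _ → x)

  nat : ℕ → Carrier
  nat n = ∑ n (λ _ → 1#)

  ^^-cong : ∀ n {x y} → x ≈ y → x ^^ n ≈ y ^^ n
  ^^-cong n x≈y = Product.fold-cong n λ _ _ → x≈y

  ^^-+ : ∀ x m n → x ^^ (m ℕ.+ n) ≈ x ^^ m * x ^^ n
  ^^-+ x m n = Product.fold-+ m n _

  ^^-* : ∀ x m n → x ^^ (m ℕ.* n) ≈ (x ^^ m) ^^ n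
  ^^-* x m n = Product.fold-* m n x

  ^^-≡ : ∀ x {m n} → m ≡ n → x ^^ m ≈ x ^^ n
  ^^-≡ x ≡.refl = refl

  x^^m≈1⇒x^^m*n≈1 : ∀ {x m} → x ^^ m ≈ 1# → ∀ n → x ^^ (m ℕ.* n) ≈ 1#
  x^^m≈1⇒x^^m*n≈1 {x} {m} eq n = trans (^^-* x m n) (trans (^^-cong n eq) (Product.fold-ε n))

  ∑-*ˡ : ∀ x n f → ∑ n (λ i → x * f i) ≈ x * ∑ n f
  ∑-*ˡ x zero f = sym (zeroʳ x)
  ∑-*ˡ x (suc n) f = trans (+-congʳ (∑-*ˡ x n f)) (sym (distribˡ _ _ _))

  nat-* : ∀ m n → nat (m ℕ.* n) ≈ nat m * nat n
  nat-* m n = begin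
    nat (m ℕ.* n)              ≈⟨ Sum.fold-* m n 1# ⟩
    ∑ n (λ _ → nat m)          ≈⟨ Sum.fold-cong n (λ _ _ → sym (*-identityʳ _)) ⟩
    ∑ n (λ _ → nat m * 1#)     ≈⟨ ∑-*ˡ (nat m) n _ ⟩
    nat m * nat n              ∎

  geometricSum : ∀ x n → (x - 1#) * ∑ n (λ i → x ^^ i) ≈ x ^^ n - 1#
  geometricSum x zero = trans (zeroʳ _) (sym (-‿inverseʳ 1#))
  geometricSum x (suc n) = begin
    (x - 1#) * (∑ n (λ i → x ^^ i) + x ^^ n)             ≈⟨ distribˡ _ _ _ ⟩
    (x - 1#) * ∑ n (λ i → x ^^ i) + (x - 1#) * x ^^ n    ≈⟨ +-congʳ (geometricSum x n) ⟩
    (x ^^ n - 1#) + (x - 1#) * x ^^ n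
      ≈⟨ solve 2 (λ x y → (y :- :1) :+ (x :- :1) :* y := y :* x :- :1) refl x (x ^^ n) ⟩
    x ^^ n * x - 1#                                       ∎

  ∏-neg : ∀ n f → ∏ n (λ i → - f i) ≈ (- 1#) ^^ n * ∏ n f
  ∏-neg n f = trans
    (Product.fold-cong n λ i _ → solve 1 (λ x → :- x := (:- :1) :* x) refl (f i))
    (Product.fold-∙ n _ f)

  [-1]^^even : ∀ n → (- 1#) ^^ (n ℕ.+ n) ≈ 1#
  [-1]^^even n = begin
    (- 1#) ^^ (n ℕ.+ n)                       ≈⟨ ^^-+ (- 1#) n n ⟩
    (- 1#) ^^ n * (- 1#) ^^ n                 ≈⟨ sym (Product.fold-∙ n _ _) ⟩
    (- 1# * - 1#) ^^ n
      ≈⟨ ^^-cong n (solve 0 ((:- :1) :* (:- :1) := :1) refl) ⟩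
    1# ^^ n                                   ≈⟨ Product.fold-ε n ⟩
    1#                                        ∎

  -- Inserting (-1)^(2l) = 1 beside (-1)^k produces the odd power (-1)^(k+l), with no case
  -- distinction on parities.
  [-1]^^-antisymmetric : ∀ k l t → k ℕ.+ l ≡ suc (t ℕ.+ t) → (- 1#) ^^ l + (- 1#) ^^ k ≈ 0#
  [-1]^^-antisymmetric k l t k+l≡ = begin
    e l + e k                          ≈⟨ +-congˡ (sym (*-identityʳ _)) ⟩
    e l + e k * 1#                     ≈⟨ +-congˡ (*-congˡ (sym ([-1]^^even l))) ⟩
    e l + e k * e (l ℕ.+ l)            ≈⟨ +-congˡ (*-congˡ (^^-+ _ l l)) ⟩
    e l + e k * (e l * e l)            ≈⟨ +-congˡ (sym (*-assoc _ _ _)) ⟩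
    e l + e k * e l * e l              ≈⟨ +-congˡ (*-congʳ (sym (^^-+ _ k l))) ⟩
    e l + e (k ℕ.+ l) * e l            ≈⟨ +-congˡ (*-congʳ (^^-≡ _ k+l≡)) ⟩
    e l + e (t ℕ.+ t) * (- 1#) * e l   ≈⟨ +-congˡ (*-congʳ (*-congʳ ([-1]^^even t))) ⟩
    e l + 1# * (- 1#) * e l            ≈⟨ solve 1 (λ x → x :+ :1 :* (:- :1) :* x := con (0 , 0)) refl (e l) ⟩
    0#                                 ∎
    where
    e : ℕ → Carrier
    e n = (- 1#) ^^ n

  -- The outermost pair is stripped off at each step. An even number of terms leaves no middle one,
  -- about which only f + f = 0 would be known.
  ∑-antisymmetric : ∀ s f → (∀ i j → suc (i ℕ.+ j) ≡ s ℕ.+ s → f i + f j ≈ 0#) → ∑ (s ℕ.+ s) f ≈ 0#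
  ∑-antisymmetric zero f pairs = refl
  ∑-antisymmetric (suc s) f pairs rewrite ℕₚ.+-suc s s = begin
    ∑ (suc (s ℕ.+ s)) f + f (suc (s ℕ.+ s))
      ≈⟨ +-congʳ (Sum.fold-head (s ℕ.+ s) f) ⟩
    (f 0 + ∑ (s ℕ.+ s) (λ i → f (suc i))) + f (suc (s ℕ.+ s))
      ≈⟨ +-congʳ (+-congˡ (∑-antisymmetric s (λ i → f (suc i)) λ i j i+j → pairs (suc i) (suc j)
           (≡.cong suc (≡.trans (≡.cong suc (ℕₚ.+-suc i j)) (≡.cong suc i+j))))) ⟩
    (f 0 + 0#) + f (suc (s ℕ.+ s))            ≈⟨ +-congʳ (+-identityʳ _) ⟩
    f 0 + f (suc (s ℕ.+ s))                   ≈⟨ pairs 0 (suc (s ℕ.+ s)) ≡.refl ⟩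
    0#                                        ∎

-- Quotients by a principal ideal

module Quotient {c ℓ} (R : CommutativeRing c ℓ) (d : CommutativeRing.Carrier R) where
  open CommutativeRing R
  open IntegerCoefficients R using (solve; con; _:=_; _:+_; _:*_; :-_; _:-_)

  infix 4 _≈/_
  -- The multiplier is kept as data: it later becomes the cofactor in divisibility statements over
  -- the original ring.
  record _≈/_ (x y : Carrier) : Set (c ⊔ ℓ) where
    constructor _,_
    field
      multiplier : Carrier
      equation : x ≈ y + d * multiplier

  embed : ∀ {x y} → x ≈ y → x ≈/ y
  embed x≈y = 0# , trans x≈y (sym (trans (+-congˡ (zeroʳ d)) (+-identityʳ _)))

  quotientRing : CommutativeRing c (c ⊔ ℓ)
  quotientRing = record
    { Carrier = Carrier
    ; _≈_ = _≈/_
    ; _+_ = _+_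
    ; _*_ = _*_
    ; -_ = -_
    ; 0# = 0#
    ; 1# = 1#
    ; isCommutativeRing = record
      { isRing = record
        { +-isAbelianGroup = record
          { isGroup = record
            { isMonoid = record
              { isSemigroup = record
                { isMagma = record
                  { isEquivalence = record
                    { refl = embed refl
                    ; sym = λ { {x} {y} (u , eq) → - u , trans
                        (solve 3 (λ d y u → y := (y :+ d :* u) :+ d :* (:- u)) refl d y u)
                        (+-congʳ (sym eq)) }
                    ; trans = λ { {x} {y} {z} (u , eq) (v , eq′) → v + u , trans eq (trans
                        (+-congʳ eq′)
                        (solve 4 (λ d z u v → z :+ d :* v :+ d :* u := z :+ d :* (v :+ u)) refl d z u v)) }
                    }
                  ; ∙-cong = λ { {x} {y} {z} {w} (u , eq) (v , eq′) → u + v , trans (+-cong eq eq′)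
                      (solve 5 (λ d y w u v →
                        (y :+ d :* u) :+ (w :+ d :* v) := (y :+ w) :+ d :* (u :+ v)) refl d y w u v) }
                  }
                ; assoc = λ x y z → embed (+-assoc x y z)
                }
              ; identity = (λ x → embed (+-identityˡ x)) , (λ x → embed (+-identityʳ x))
              }
            ; inverse = (λ x → embed (-‿inverseˡ x)) , (λ x → embed (-‿inverseʳ x))
            ; ⁻¹-cong = λ { {x} {y} (u , eq) → - u , trans (-‿cong eq)
                (solve 3 (λ d y u → :- (y :+ d :* u) := :- y :+ d :* (:- u)) refl d y u) }
            }
          ; comm = λ x y → embed (+-comm x y)
          }
        ; *-cong = λ { {x} {y} {z} {w} (u , eq) (v , eq′) → y * v + u * w + u * (d * v) ,
            trans (*-cong eq eq′)
              (solve 5 (λ d y w u v → (y :+ d :* u) :* (w :+ d :* v) :=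
                y :* w :+ d :* (y :* v :+ u :* w :+ u :* (d :* v))) refl d y w u v) }
        ; *-assoc = λ x y z → embed (*-assoc x y z)
        ; *-identity = (λ x → embed (*-identityˡ x)) , (λ x → embed (*-identityʳ x))
        ; distrib = (λ x y z → embed (distribˡ x y z)) , (λ x y z → embed (distribʳ x y z))
        }
      ; *-comm = λ x y → embed (*-comm x y)
      }
    }

  x≈1+[x-1] : ∀ x → d ≈ x - 1# → x ≈/ 1#
  x≈1+[x-1] x d≈x-1 = 1# , trans
    (solve 1 (λ x → x := con (1 , 0) :+ (x :- con (1 , 0)) :* con (1 , 0)) refl x)
    (+-congˡ (*-congʳ (sym d≈x-1)))

-- Reflection of the summands modulo q^n - 1

module Summands {c ℓ} (R : CommutativeRing c ℓ) (q a : CommutativeRing.Carrier R) where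
  open CommutativeRing R hiding (zero)
  open RingFolds R
  open IntegerCoefficients R
  open import Relation.Binary.Reasoning.Setoid setoid

  -- The factor a - x is 1 - x/a cleared of its denominator. The last `a` is left by the same
  -- clearing in the other half of the summand, since numerator and denominator each bring a^k.
  F : Carrier → Carrier
  F x = (1# - a * x) * (a - x) * (1# - x * x) * a

  -- Spread v⁴ as v, v, v² over the three factors containing u. The first becomes -(a - v), the
  -- second -(1 - av), the third -(1 - v²), and three signs leave one.
  F-inverse : ∀ {u v} → u * v ≈ 1# → v ^^ 4 * F u ≈ - F v
  F-inverse {u} {v} uv≈1 = begin
    v ^^ 4 * F u
      ≈⟨ solve 3 (λ a u v →
           (((:1 :* v) :* v) :* v) :* v :* ((:1 :- a :* u) :* (a :- u) :* (:1 :- u :* u) :* a) :=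
           (v :- a :* (u :* v)) :* (a :* v :- u :* v) :* (v :* v :- (u :* v) :* (u :* v)) :* a)
         refl a u v ⟩
    (v - a * (u * v)) * (a * v - u * v) * (v * v - (u * v) * (u * v)) * a
      ≈⟨ *-congʳ (*-cong (*-cong (+-congˡ (-‿cong (*-congˡ uv≈1))) (+-congˡ (-‿cong uv≈1)))
           (+-congˡ (-‿cong (*-cong uv≈1 uv≈1)))) ⟩
    (v - a * 1#) * (a * v - 1#) * (v * v - 1# * 1#) * a
      ≈⟨ solve 2 (λ a v →
           (v :- a :* :1) :* (a :* v :- :1) :* (v :* v :- :1 :* :1) :* a :=
           :- ((:1 :- a :* v) :* (a :- v) :* (:1 :- v :* v) :* a))
         refl a v ⟩
    - F v ∎

  odds evens : ℕ → Carrier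
  odds j = F (q ^^ (2 ℕ.* j ℕ.+ 1))
  evens j = F (q ^^ (2 ℕ.* j ℕ.+ 2))

  -- The order is descending so that the i-th factor meets its inverse partner `odds i`: the
  -- exponents 2(k + l) - 2i and 2i + 1 add up to 2(k + l) + 1, which is n when k + l = m.
  evensTail : ℕ → ℕ → Carrier
  evensTail k l = ∏ l (λ i → evens (k ℕ.+ (l ℕ.∸ suc i)))

  -- For k + l = m, the numerator of the k-th summand over the common denominator; the separate
  -- argument l lets the reflection be a swap.
  T : ℕ → ℕ → Carrier
  T k l = q ^^ (2 ℕ.* k) * ∏ k odds * evensTail k l

  progression : ∀ s t j → q ^^ s * (q ^^ t) ^^ j ≈ q ^^ (t ℕ.* j ℕ.+ s)
  progression s t j = trans (*-congˡ (sym (^^-* q t j)))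
    (trans (*-comm _ _) (sym (^^-+ q (t ℕ.* j) s)))

  progression-square : ∀ s j → q ^^ (s ℕ.+ s) * (q ^^ 4) ^^ j ≈
    q ^^ (2 ℕ.* j ℕ.+ s) * q ^^ (2 ℕ.* j ℕ.+ s)
  progression-square s j = trans (progression (s ℕ.+ s) 4 j)
    (trans (^^-≡ q (double s j)) (^^-+ q (2 ℕ.* j ℕ.+ s) (2 ℕ.* j ℕ.+ s)))
    where
    double : ∀ s j → 4 ℕ.* j ℕ.+ (s ℕ.+ s) ≡ (2 ℕ.* j ℕ.+ s) ℕ.+ (2 ℕ.* j ℕ.+ s)
    double = solve-∀

  -- Used with s = 1 for `odds` and s = 2 for `evens`. The parameters are fixed only up to `≈`
  -- because at s = 1 the fractions carry `q`, whereas `q ^^ 1` unfolds to `1# * q`.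
  ∏-F : ∀ s k {x y z} → x ≈ a * q ^^ s → y ≈ q ^^ s → z ≈ q ^^ (s ℕ.+ s) →
    ((∏ k (λ j → 1# - x * (q ^^ 2) ^^ j) * ∏ k (λ j → a - y * (q ^^ 2) ^^ j)) *
      ∏ k (λ j → 1# - z * (q ^^ 4) ^^ j)) * ∏ k (λ _ → a) ≈
    ∏ k (λ j → F (q ^^ (2 ℕ.* j ℕ.+ s)))
  ∏-F s k {x} {y} {z} x≈ y≈ z≈ = sym (begin
    ∏ k (λ j → F (q ^^ (2 ℕ.* j ℕ.+ s)))
      ≈⟨ Product.fold-cong k (λ j _ → sym (*-congʳ (*-cong (*-cong
           (+-congˡ (-‿cong (trans (*-congʳ x≈) (trans (*-assoc _ _ _) (*-congˡ (progression s 2 j))))))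
           (+-congˡ (-‿cong (trans (*-congʳ y≈) (progression s 2 j)))))
           (+-congˡ (-‿cong (trans (*-congʳ z≈) (progression-square s j))))))) ⟩
    ∏ k (λ j → ((1# - x * (q ^^ 2) ^^ j) * (a - y * (q ^^ 2) ^^ j)) * (1# - z * (q ^^ 4) ^^ j) * a)
      ≈⟨ trans (Product.fold-∙ k _ _) (*-congʳ
           (trans (Product.fold-∙ k _ _) (*-congʳ (Product.fold-∙ k _ _)))) ⟩
    ((∏ k (λ j → 1# - x * (q ^^ 2) ^^ j) * ∏ k (λ j → a - y * (q ^^ 2) ^^ j)) *
      ∏ k (λ j → 1# - z * (q ^^ 4) ^^ j)) * ∏ k (λ _ → a) ∎)

  -- The stray units and the product of `a`'s are what unreduced fraction arithmetic leaves in
  -- `rep-term`.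
  numerators : ∀ k →
    (((∏ k (λ j → 1# - a * q * (q ^^ 2) ^^ j) * ∏ k (λ j → a - q * (q ^^ 2) ^^ j)) *
      ∏ k (λ j → 1# - q ^^ 2 * (q ^^ 4) ^^ j)) * q ^^ (2 ℕ.* k)) * ((1# * ∏ k (λ _ → a)) * 1#) ≈
    q ^^ (2 ℕ.* k) * ∏ k odds
  numerators k = trans
    (solve 3 (λ x y p → (x :* y) :* ((:1 :* p) :* :1) := y :* (x :* p)) refl _ (q ^^ (2 ℕ.* k)) (∏ k (λ _ → a)))
    (*-congˡ (∏-F 1 k (*-congˡ (sym (*-identityˡ q))) (sym (*-identityˡ q)) refl))

  denominators : ∀ k →
    (((1# * ∏ k (λ _ → a)) * 1#) * 1#) *
      ((∏ k (λ j → 1# - a * q ^^ 2 * (q ^^ 2) ^^ j) * ∏ k (λ j → a - q ^^ 2 * (q ^^ 2) ^^ j)) *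
        ∏ k (λ j → 1# - q ^^ 4 * (q ^^ 4) ^^ j)) ≈
    ∏ k evens
  denominators k = trans
    (solve 2 (λ x p → (((:1 :* p) :* :1) :* :1) :* x := x :* p) refl _ (∏ k (λ _ → a)))
    (∏-F 2 k refl refl refl)

  -- The first l odd numbers sum to l².
  ∏-odd-powers : ∀ l → ∏ l (λ i → (q ^^ (2 ℕ.* i ℕ.+ 1)) ^^ 4) ≈ q ^^ (4 ℕ.* (l ℕ.* l))
  ∏-odd-powers zero = refl
  ∏-odd-powers (suc l) = begin
    ∏ l (λ i → (q ^^ (2 ℕ.* i ℕ.+ 1)) ^^ 4) * (q ^^ (2 ℕ.* l ℕ.+ 1)) ^^ 4
      ≈⟨ *-cong (∏-odd-powers l) (sym (^^-* q (2 ℕ.* l ℕ.+ 1) 4)) ⟩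
    q ^^ (4 ℕ.* (l ℕ.* l)) * q ^^ ((2 ℕ.* l ℕ.+ 1) ℕ.* 4)
      ≈⟨ sym (^^-+ q (4 ℕ.* (l ℕ.* l)) _) ⟩
    q ^^ (4 ℕ.* (l ℕ.* l) ℕ.+ (2 ℕ.* l ℕ.+ 1) ℕ.* 4)
      ≈⟨ ^^-≡ q (square l) ⟩
    q ^^ (4 ℕ.* (suc l ℕ.* suc l)) ∎
    where
    square : ∀ l → 4 ℕ.* (l ℕ.* l) ℕ.+ (2 ℕ.* l ℕ.+ 1) ℕ.* 4 ≡ 4 ℕ.* (suc l ℕ.* suc l)
    square = solve-∀

  module _ (m : ℕ) (q^n≈1 : q ^^ (2 ℕ.* m ℕ.+ 1) ≈ 1#) where

    evensTail-reflection : ∀ k l → k ℕ.+ l ≡ m →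
      q ^^ (4 ℕ.* (l ℕ.* l)) * evensTail k l ≈ (- 1#) ^^ l * ∏ l odds
    evensTail-reflection k l ≡.refl = begin
      q ^^ (4 ℕ.* (l ℕ.* l)) * evensTail k l
        ≈⟨ *-congʳ (sym (∏-odd-powers l)) ⟩
      ∏ l (λ i → (q ^^ (2 ℕ.* i ℕ.+ 1)) ^^ 4) * evensTail k l
        ≈⟨ sym (Product.fold-∙ l _ _) ⟩
      ∏ l (λ i → (q ^^ (2 ℕ.* i ℕ.+ 1)) ^^ 4 * evens (k ℕ.+ (l ℕ.∸ suc i)))
        ≈⟨ Product.fold-cong l (λ i i<l → F-inverse (inverse i i<l)) ⟩
      ∏ l (λ i → - odds i)
        ≈⟨ ∏-neg l odds ⟩
      (- 1#) ^^ l * ∏ l odds ∎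
      where
      exponents : ∀ k r i → 2 ℕ.* (k ℕ.+ r) ℕ.+ 2 ℕ.+ (2 ℕ.* i ℕ.+ 1) ≡
        2 ℕ.* (k ℕ.+ (r ℕ.+ suc i)) ℕ.+ 1
      exponents = solve-∀
      inverse : ∀ i → i ℕ.< l →
        q ^^ (2 ℕ.* (k ℕ.+ (l ℕ.∸ suc i)) ℕ.+ 2) * q ^^ (2 ℕ.* i ℕ.+ 1) ≈ 1#
      inverse i i<l = begin
        q ^^ (2 ℕ.* (k ℕ.+ (l ℕ.∸ suc i)) ℕ.+ 2) * q ^^ (2 ℕ.* i ℕ.+ 1)
          ≈⟨ sym (^^-+ q (2 ℕ.* (k ℕ.+ (l ℕ.∸ suc i)) ℕ.+ 2) _) ⟩
        q ^^ (2 ℕ.* (k ℕ.+ (l ℕ.∸ suc i)) ℕ.+ 2 ℕ.+ (2 ℕ.* i ℕ.+ 1))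
          ≈⟨ ^^-≡ q (≡.trans (exponents k (l ℕ.∸ suc i) i)
               (≡.cong (λ r → 2 ℕ.* (k ℕ.+ r) ℕ.+ 1) (ℕₚ.m∸n+n≡m i<l))) ⟩
        q ^^ (2 ℕ.* (k ℕ.+ l) ℕ.+ 1)
          ≈⟨ q^n≈1 ⟩
        1# ∎

    -- The part 4l² pays for the reflection of `evensTail`. The rest, 4k² + 4kl, adds up with the
    -- exponent 2k of the summand to 2k(2(k + l) + 1) = 2kn, a period; and the total is symmetric in
    -- k and l.
    weight : ℕ → ℕ → ℕ
    weight k l = 4 ℕ.* (k ℕ.* k ℕ.+ k ℕ.* l ℕ.+ l ℕ.* l)

    weight-T : ∀ k l → k ℕ.+ l ≡ m →
      q ^^ weight k l * T k l ≈ (- 1#) ^^ l * (∏ k odds * ∏ l odds)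
    weight-T k l k+l≡m = begin
      q ^^ weight k l * (q ^^ (2 ℕ.* k) * ∏ k odds * evensTail k l)
        ≈⟨ *-congʳ (trans (^^-≡ q (split k l))
             (^^-+ q (4 ℕ.* (k ℕ.* k) ℕ.+ 4 ℕ.* (k ℕ.* l)) _)) ⟩
      x * y * (q ^^ (2 ℕ.* k) * ∏ k odds * evensTail k l)
        ≈⟨ solve 5 (λ x y z g e → x :* y :* (z :* g :* e) := (x :* z) :* g :* (y :* e)) refl
             x y (q ^^ (2 ℕ.* k)) (∏ k odds) (evensTail k l) ⟩
      (x * q ^^ (2 ℕ.* k)) * ∏ k odds * (y * evensTail k l)
        ≈⟨ *-cong (*-congʳ period) (evensTail-reflection k l k+l≡m) ⟩
      1# * ∏ k odds * ((- 1#) ^^ l * ∏ l odds)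
        ≈⟨ solve 3 (λ g e h → :1 :* g :* (e :* h) := e :* (g :* h)) refl
             (∏ k odds) ((- 1#) ^^ l) (∏ l odds) ⟩
      (- 1#) ^^ l * (∏ k odds * ∏ l odds) ∎
      where
      x y : Carrier
      x = q ^^ (4 ℕ.* (k ℕ.* k) ℕ.+ 4 ℕ.* (k ℕ.* l))
      y = q ^^ (4 ℕ.* (l ℕ.* l))
      split : ∀ k l → 4 ℕ.* (k ℕ.* k ℕ.+ k ℕ.* l ℕ.+ l ℕ.* l) ≡
        4 ℕ.* (k ℕ.* k) ℕ.+ 4 ℕ.* (k ℕ.* l) ℕ.+ 4 ℕ.* (l ℕ.* l)
      split = solve-∀
      exponents : ∀ k l → 4 ℕ.* (k ℕ.* k) ℕ.+ 4 ℕ.* (k ℕ.* l) ℕ.+ 2 ℕ.* k ≡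
        (2 ℕ.* (k ℕ.+ l) ℕ.+ 1) ℕ.* (2 ℕ.* k)
      exponents = solve-∀
      period : x * q ^^ (2 ℕ.* k) ≈ 1#
      period = begin
        x * q ^^ (2 ℕ.* k)
          ≈⟨ sym (^^-+ q (4 ℕ.* (k ℕ.* k) ℕ.+ 4 ℕ.* (k ℕ.* l)) _) ⟩
        q ^^ (4 ℕ.* (k ℕ.* k) ℕ.+ 4 ℕ.* (k ℕ.* l) ℕ.+ 2 ℕ.* k)
          ≈⟨ ^^-≡ q (≡.trans (exponents k l)
               (≡.cong (λ i → (2 ℕ.* i ℕ.+ 1) ℕ.* (2 ℕ.* k)) k+l≡m)) ⟩
        q ^^ ((2 ℕ.* m ℕ.+ 1) ℕ.* (2 ℕ.* k))
          ≈⟨ x^^m≈1⇒x^^m*n≈1 {m = 2 ℕ.* m ℕ.+ 1} q^n≈1 (2 ℕ.* k) ⟩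
        1# ∎

    -- The inverse of q^e is q^(2me), since the exponents add up to ne.
    ^^-cancelˡ-0 : ∀ e {x} → q ^^ e * x ≈ 0# → x ≈ 0#
    ^^-cancelˡ-0 e {x} q^e*x≈0 = begin
      x                                     ≈⟨ sym (*-identityˡ x) ⟩
      1# * x                                ≈⟨ *-congʳ (sym (x^^m≈1⇒x^^m*n≈1 {m = 2 ℕ.* m ℕ.+ 1} q^n≈1 e)) ⟩
      q ^^ ((2 ℕ.* m ℕ.+ 1) ℕ.* e) * x      ≈⟨ *-congʳ (^^-≡ q (exponents m e)) ⟩
      q ^^ (2 ℕ.* m ℕ.* e ℕ.+ e) * x        ≈⟨ *-congʳ (^^-+ q (2 ℕ.* m ℕ.* e) e) ⟩
      q ^^ (2 ℕ.* m ℕ.* e) * q ^^ e * x     ≈⟨ *-assoc _ _ _ ⟩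
      q ^^ (2 ℕ.* m ℕ.* e) * (q ^^ e * x)   ≈⟨ *-congˡ q^e*x≈0 ⟩
      q ^^ (2 ℕ.* m ℕ.* e) * 0#             ≈⟨ zeroʳ _ ⟩
      0#                                    ∎
      where
      exponents : ∀ m e → (2 ℕ.* m ℕ.+ 1) ℕ.* e ≡ 2 ℕ.* m ℕ.* e ℕ.+ e
      exponents = solve-∀

    T-antisymmetric : ∀ t → m ≡ suc (t ℕ.+ t) → ∀ k l → k ℕ.+ l ≡ m → T k l + T l k ≈ 0#
    T-antisymmetric t m-odd k l k+l≡m = ^^-cancelˡ-0 (weight k l) (begin
      q ^^ weight k l * (T k l + T l k)
        ≈⟨ distribˡ _ _ _ ⟩
      q ^^ weight k l * T k l + q ^^ weight k l * T l k
        ≈⟨ +-cong (weight-T k l k+l≡m)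
             (trans (*-congʳ (^^-≡ q (weight-sym k l)))
               (weight-T l k (≡.trans (ℕₚ.+-comm l k) k+l≡m))) ⟩
      (- 1#) ^^ l * (∏ k odds * ∏ l odds) + (- 1#) ^^ k * (∏ l odds * ∏ k odds)
        ≈⟨ solve 4 (λ e f g h → e :* (g :* h) :+ f :* (h :* g) := (e :+ f) :* (g :* h)) refl
             ((- 1#) ^^ l) ((- 1#) ^^ k) (∏ k odds) (∏ l odds) ⟩
      ((- 1#) ^^ l + (- 1#) ^^ k) * (∏ k odds * ∏ l odds)
        ≈⟨ *-congʳ ([-1]^^-antisymmetric k l t (≡.trans k+l≡m m-odd)) ⟩
      0# * (∏ k odds * ∏ l odds)
        ≈⟨ zeroˡ _ ⟩
      0# ∎)
      where
      weight-sym : ∀ k l → 4 ℕ.* (k ℕ.* k ℕ.+ k ℕ.* l ℕ.+ l ℕ.* l) ≡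
        4 ℕ.* (l ℕ.* l ℕ.+ l ℕ.* k ℕ.+ k ℕ.* k)
      weight-sym = solve-∀

    -- Odd m gives m + 1 = 2(t + 1) summands, so k ↦ m - k fixes no index.
    ∑-T≈0 : ∀ t → m ≡ suc (t ℕ.+ t) → ∑ (suc m) (λ k → T k (m ℕ.∸ k)) ≈ 0#
    ∑-T≈0 t ≡.refl = trans (reflexive (≡.cong (λ i → ∑ i term) (≡.sym (≡.cong suc (ℕₚ.+-suc t t)))))
      (∑-antisymmetric (suc t) term λ i j i+j≡ → antisymmetric i j
        (ℕₚ.suc-injective (≡.trans i+j≡ (≡.cong suc (ℕₚ.+-suc t t)))))
      where
      term : ℕ → Carrier
      term k = T k (m ℕ.∸ k)
      antisymmetric : ∀ i j → i ℕ.+ j ≡ m → term i + term j ≈ 0#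
      antisymmetric i j i+j≡m = trans
        (+-cong (reflexive (≡.cong (T i) (complement i j i+j≡m)))
          (reflexive (≡.cong (T j) (complement j i (≡.trans (ℕₚ.+-comm j i) i+j≡m)))))
        (T-antisymmetric t ≡.refl i j i+j≡m)
        where
        complement : ∀ i j → i ℕ.+ j ≡ m → m ℕ.∸ i ≡ j
        complement i j i+j≡m = ≡.trans (≡.cong (ℕ._∸ i) (≡.sym i+j≡m)) (ℕₚ.m+n∸m≡n i j)

-- Roots of unity and divisors of nonzero integers

module RootsOfUnity {c ℓ} (R : CommutativeRing c ℓ) where
  open CommutativeRing R hiding (zero)
  open RingFolds R
  open import Relation.Binary.Reasoning.Setoid setoid

  ^^≈1-∣ : ∀ {x m n} → m ℕ∣.∣ n → x ^^ m ≈ 1# → x ^^ n ≈ 1#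
  ^^≈1-∣ {x} {m} (ℕ∣.divides c ≡.refl) x^m≈1 =
    trans (^^-≡ x (ℕₚ.*-comm c m)) (x^^m≈1⇒x^^m*n≈1 {m = m} x^m≈1 c)

  ^^≈1-cancel : ∀ {x} d {r s} → d ℕ.+ r ≡ s → x ^^ r ≈ 1# → x ^^ s ≈ 1# → x ^^ d ≈ 1#
  ^^≈1-cancel {x} d {r} ≡.refl x^r≈1 x^s≈1 = begin
    x ^^ d            ≈⟨ sym (*-identityʳ _) ⟩
    x ^^ d * 1#       ≈⟨ *-congˡ (sym x^r≈1) ⟩
    x ^^ d * x ^^ r   ≈⟨ sym (^^-+ x d r) ⟩
    x ^^ (d ℕ.+ r)    ≈⟨ x^s≈1 ⟩
    1#                ∎

  -- Over ℕ, Bézout says that the gcd plus a multiple of one exponent is a multiple of the other;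
  -- the powers to both multiples are 1.
  ^^≈1-gcd : ∀ {x m n} → x ^^ m ≈ 1# → x ^^ n ≈ 1# → x ^^ gcd m n ≈ 1#
  ^^≈1-gcd {x} {m} {n} x^m≈1 x^n≈1 with Bézout.identity (gcd-GCD m n)
  ... | Bézout.+- i j eq = ^^≈1-cancel (gcd m n) eq
    (^^≈1-∣ {x} {n} (ℕ∣.divides j ≡.refl) x^n≈1) (^^≈1-∣ {x} {m} (ℕ∣.divides i ≡.refl) x^m≈1)
  ... | Bézout.-+ i j eq = ^^≈1-cancel (gcd m n) eq
    (^^≈1-∣ {x} {m} (ℕ∣.divides i ≡.refl) x^m≈1) (^^≈1-∣ {x} {n} (ℕ∣.divides j ≡.refl) x^n≈1)

  geometricSum-unity : ∀ x n → x ≈ 1# → ∑ n (λ i → x ^^ i) ≈ nat n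
  geometricSum-unity x n x≈1 = Sum.fold-cong n λ i _ → trans (^^-cong i x≈1) (Product.fold-ε i)

module DivisorsOfIntegers {c ℓ} (R : CommutativeRing c ℓ) where
  open CommutativeRing R hiding (zero)
  open RingFolds R
  open IntegerCoefficients R

  -- A weakening of being a unit that is still multiplicative. If n is a power of a prime p, then 1
  -- - q^e with n ∤ e is no unit modulo Φ_n, but it divides p.
  record DividesInteger (x : Carrier) : Set (c ⊔ ℓ) where
    constructor dividesInteger
    field
      integer : ℕ
      {{integer≢0}} : ℕ.NonZero integer
      cofactor : Carrier
      factorization : nat integer ≈ x * cofactor

  dividesInteger-* : ∀ {x y} → DividesInteger x → DividesInteger y → DividesInteger (x * y)
  dividesInteger-* {x} {y} (dividesInteger m u m≈xu) (dividesInteger n v n≈yv) =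
    dividesInteger (m ℕ.* n) {{ℕₚ.m*n≢0 m n}} (u * v)
      (trans (nat-* m n) (trans (*-cong m≈xu n≈yv)
        (solve 4 (λ x u y v → (x :* u) :* (y :* v) := (x :* y) :* (u :* v)) refl x u y v)))

  dividesInteger-1 : DividesInteger 1#
  dividesInteger-1 = dividesInteger 1 1# (trans (+-identityˡ 1#) (sym (*-identityˡ 1#)))

  dividesInteger-factor : ∀ {x y z} → x ≈ y * z → DividesInteger x → DividesInteger y
  dividesInteger-factor {x} {y} {z} x≈yz (dividesInteger m u m≈xu) =
    dividesInteger m (z * u) (trans m≈xu (trans (*-congʳ x≈yz) (*-assoc y z u)))

  dividesInteger-cong : ∀ {x y} → x ≈ y → DividesInteger x → DividesInteger y
  dividesInteger-cong x≈y = dividesInteger-factor (trans x≈y (sym (*-identityʳ _)))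

  dividesInteger-∏ : ∀ n f → (∀ i → i ℕ.< n → DividesInteger (f i)) → DividesInteger (∏ n f)
  dividesInteger-∏ zero f div = dividesInteger-1
  dividesInteger-∏ (suc n) f div = dividesInteger-*
    (dividesInteger-∏ n f λ i i<n → div i (ℕₚ.m<n⇒m<1+n i<n)) (div n ℕₚ.≤-refl)

  -- With x = q ^ gcd e n the hypothesis reduces to the vanishing of the number
  -- of summands in the quotient by q ^ e - 1.
  dividesInteger-1-^^ : ∀ q n e w {{_ : ℕ.NonZero w}} → q ^^ n ≈ 1# →
    ∑ w (λ i → (q ^^ gcd e n) ^^ i) ≈ 0# → DividesInteger (1# - q ^^ e)
  dividesInteger-1-^^ q n e w q^n≈1 sum≈0 = dividesInteger w u (trans w≈ (+-identityˡ _))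
    where
    open Quotient R (1# - q ^^ e)
    module Q = CommutativeRing quotientRing
    open RootsOfUnity quotientRing
    q^e≈1 : q ^^ e ≈/ 1#
    q^e≈1 = - 1# , solve 1 (λ x → x := :1 :+ (:1 :- x) :* (:- :1)) refl (q ^^ e)
    w≈0 : nat w ≈/ 0#
    w≈0 = Q.trans (Q.sym (geometricSum-unity (q ^^ gcd e n) w
      (^^≈1-gcd {q} {e} {n} q^e≈1 (embed q^n≈1)))) (embed sum≈0)
    open _≈/_ w≈0 renaming (multiplier to u; equation to w≈)

-- Cyclotomic factorizations of q^n - 1

module CyclotomicFactors {c ℓ} (R : CommutativeRing c ℓ) (q : CommutativeRing.Carrier R)
  (Φ : ℕ → CommutativeRing.Carrier R) where
  open CommutativeRing R hiding (zero)
  open RingFolds R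
  open IntegerCoefficients R
  open import Relation.Binary.Reasoning.Setoid setoid

  -- Repeats the factor in `IsCyclotomic` literally, so that the hypothesis applies by conversion.
  factor : ℕ → ℕ → Carrier
  factor n d = if does (d ℕ∣.∣? n) then (if does (d ℕ.≟ 0) then 1# else Φ d) else 1#

  newFactor : ℕ → ℕ → ℕ → Carrier
  newFactor d n e = if does (e ℕ∣.∣? d) then 1# else factor n e

  factor-∣ : ∀ {d n} → d ℕ∣.∣ n → factor n d ≡ (if does (d ℕ.≟ 0) then 1# else Φ d)
  factor-∣ {d} {n} d∣n rewrite dec-true (d ℕ∣.∣? n) d∣n = ≡.refl

  factor-∤ : ∀ {d n} → ¬ d ℕ∣.∣ n → factor n d ≡ 1#
  factor-∤ {d} {n} d∤n rewrite dec-false (d ℕ∣.∣? n) d∤n = ≡.refl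

  newFactor-∣ : ∀ {d n e} → e ℕ∣.∣ d → newFactor d n e ≡ 1#
  newFactor-∣ {d} {n} {e} e∣d rewrite dec-true (e ℕ∣.∣? d) e∣d = ≡.refl

  newFactor-∤ : ∀ {d n e} → ¬ e ℕ∣.∣ d → newFactor d n e ≡ factor n e
  newFactor-∤ {d} {n} {e} e∤d rewrite dec-false (e ℕ∣.∣? d) e∤d = ≡.refl

  factor-self : ∀ {n} → 1 ℕ.≤ n → factor n n ≡ Φ n
  factor-self {suc n} _ = factor-∣ {suc n} ℕ∣.∣-refl

  factor-split : ∀ {d n} → d ℕ∣.∣ n → ∀ e → factor n e ≈ factor d e * newFactor d n e
  factor-split {d} {n} d∣n e = split (e ℕ∣.∣? d)
    where
    split : Dec (e ℕ∣.∣ d) → factor n e ≈ factor d e * newFactor d n e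
    split (yes e∣d) = sym (trans (*-congˡ (reflexive (newFactor-∣ {d} {n} e∣d))) (trans (*-identityʳ _)
      (reflexive (≡.trans (factor-∣ e∣d) (≡.sym (factor-∣ (ℕ∣.∣-trans e∣d d∣n)))))))
    split (no e∤d) = sym (trans
      (*-cong (reflexive (factor-∤ e∤d)) (reflexive (newFactor-∤ e∤d))) (*-identityˡ _))

  factor-beyond : ∀ d k → 1 ℕ.≤ d → factor d (suc d ℕ.+ k) ≡ 1#
  factor-beyond (suc d) k _ = factor-∤ (λ e∣d →
    ℕₚ.<⇒≱ (ℕₚ.m≤m+n (suc (suc d)) k) (ℕ∣.∣⇒≤ e∣d))

  module _ (product : ∀ n → 1 ℕ.≤ n → ∏ (suc n) (factor n) ≈ q ^^ n - 1#) where

    Φ-cofactor : ∀ n → 1 ℕ.≤ n → q ^^ n - 1# ≈ Φ n * ∏ n (factor n)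
    Φ-cofactor n 1≤n = begin
      q ^^ n - 1#                      ≈⟨ sym (product n 1≤n) ⟩
      ∏ n (factor n) * factor n n      ≈⟨ *-comm _ _ ⟩
      factor n n * ∏ n (factor n)      ≈⟨ *-congʳ (reflexive (factor-self 1≤n)) ⟩
      Φ n * ∏ n (factor n)             ∎

    -- The divisors of n split into those of d, which multiply to q^d - 1, and the others; n is
    -- among the others because d < n.
    properDivisor : ∀ {d n} → 1 ℕ.≤ d → d ℕ.< n → d ℕ∣.∣ n →
      q ^^ n - 1# ≈ (q ^^ d - 1#) * (Φ n * ∏ n (newFactor d n))
    properDivisor {d} {n} 1≤d d<n d∣n = begin
      q ^^ n - 1#
        ≈⟨ sym (product n 1≤n) ⟩
      ∏ (suc n) (factor n)
        ≈⟨ Product.fold-cong (suc n) (λ e _ → factor-split d∣n e) ⟩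
      ∏ (suc n) (λ e → factor d e * newFactor d n e)
        ≈⟨ Product.fold-∙ (suc n) _ _ ⟩
      ∏ (suc n) (factor d) * (∏ n (newFactor d n) * newFactor d n n)
        ≈⟨ *-cong truncate (trans (*-comm _ _) (*-congʳ last)) ⟩
      (q ^^ d - 1#) * (Φ n * ∏ n (newFactor d n)) ∎
      where
      1≤n : 1 ℕ.≤ n
      1≤n = ℕₚ.≤-trans 1≤d (ℕₚ.<⇒≤ d<n)
      last : newFactor d n n ≈ Φ n
      last = reflexive (≡.trans
        (newFactor-∤ (λ n∣d → ℕₚ.<⇒≱ d<n (ℕ∣.∣⇒≤ {{ℕ.>-nonZero 1≤d}} n∣d))) (factor-self 1≤n))
      -- Indices from d + 1 to n do not divide d, so their factors are 1.
      truncate : ∏ (suc n) (factor d) ≈ q ^^ d - 1#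
      truncate = begin
        ∏ (suc n) (factor d)
          ≡⟨ ≡.cong (λ i → ∏ (suc i) (factor d)) (≡.sym (ℕₚ.m+[n∸m]≡n (ℕₚ.<⇒≤ d<n))) ⟩
        ∏ (suc d ℕ.+ (n ℕ.∸ d)) (factor d)
          ≈⟨ Product.fold-+ (suc d) (n ℕ.∸ d) _ ⟩
        ∏ (suc d) (factor d) * ∏ (n ℕ.∸ d) (λ k → factor d (suc d ℕ.+ k))
          ≈⟨ *-cong (product d 1≤d) (Product.fold-cong (n ℕ.∸ d) (λ k _ →
                reflexive (factor-beyond d k 1≤d))) ⟩
        (q ^^ d - 1#) * ∏ (n ℕ.∸ d) (λ _ → 1#)
          ≈⟨ trans (*-congˡ (Product.fold-ε (n ℕ.∸ d))) (*-identityʳ _) ⟩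
        q ^^ d - 1# ∎

    -- Both sides give q^n - 1 when multiplied by q^d - 1. Cancellation is a hypothesis because the
    -- ring is arbitrary here.
    Φ-∣-geometricSum : (∀ d → 1 ℕ.≤ d → ∀ {x y} → (q ^^ d - 1#) * x ≈ (q ^^ d - 1#) * y → x ≈ y) →
      ∀ {d n} → 1 ℕ.≤ d → d ℕ.< n → ∀ w → n ≡ w ℕ.* d →
      ∑ w (λ i → (q ^^ d) ^^ i) ≈ Φ n * ∏ n (newFactor d n)
    Φ-∣-geometricSum cancel {d} {n} 1≤d d<n w n≡w*d = cancel d 1≤d (begin
      (q ^^ d - 1#) * ∑ w (λ i → (q ^^ d) ^^ i)     ≈⟨ geometricSum (q ^^ d) w ⟩
      (q ^^ d) ^^ w - 1#                            ≈⟨ +-congʳ (sym (^^-* q d w)) ⟩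
      q ^^ (d ℕ.* w) - 1#
        ≈⟨ +-congʳ (^^-≡ q (≡.trans (ℕₚ.*-comm d w) (≡.sym n≡w*d))) ⟩
      q ^^ n - 1#                                   ≈⟨ properDivisor 1≤d d<n (ℕ∣.divides w n≡w*d) ⟩
      (q ^^ d - 1#) * (Φ n * ∏ n (newFactor d n))   ∎)

-- The denominator modulo Φ_n and a - 1

module CyclotomicModulus {c ℓ} (R : CommutativeRing c ℓ) (q a : CommutativeRing.Carrier R)
  (Φ : ℕ → CommutativeRing.Carrier R) where
  open CommutativeRing R hiding (zero)
  open RingFolds R
  open CyclotomicFactors R q Φ
  open Summands R q a
  open IntegerCoefficients R

  module Mod (product : ∀ n → 1 ℕ.≤ n → ∏ (suc n) (factor n) ≈ q ^^ n - 1#)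
    (cancel : ∀ d → 1 ℕ.≤ d → ∀ {x y} → (q ^^ d - 1#) * x ≈ (q ^^ d - 1#) * y → x ≈ y)
    (n : ℕ) (1≤n : 1 ℕ.≤ n) where

    module ModΦ = Quotient R (Φ n)
    module Mod[Φ,a-1] = Quotient ModΦ.quotientRing (a - 1#)
    -- Two successive quotients realise the ideal (Φ n, a - 1), so an equation in `S` unpacks into
    -- an explicit combination over the original ring.
    S : CommutativeRing _ _
    S = Mod[Φ,a-1].quotientRing
    module S = CommutativeRing S
    open DivisorsOfIntegers S

    embed : ∀ {x y} → x ≈ y → x S.≈ y
    embed x≈y = Mod[Φ,a-1].embed (ModΦ.embed x≈y)

    Φ-multiple : ∀ {x y} → x ≈ Φ n * y → x S.≈ 0#
    Φ-multiple {y = y} x≈Φy = Mod[Φ,a-1].embed (y ModΦ., trans x≈Φy (sym (+-identityˡ _)))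

    a≈1 : a S.≈ 1#
    a≈1 = 1# Mod[Φ,a-1]., ModΦ.embed (solve 1 (λ a → a := :1 :+ (a :- :1) :* :1) refl a)

    q^n≈1 : q ^^ n S.≈ 1#
    q^n≈1 = S.trans (embed (solve 1 (λ x → x := (x :- :1) :+ :1) refl (q ^^ n)))
      (S.trans (S.+-congʳ (Φ-multiple (Φ-cofactor product n 1≤n))) (S.+-identityˡ 1#))

    -- As n does not divide e, d = gcd(e, n) is a proper divisor of n; the integer obtained is w = n
    -- / d.
    dividesInteger-1-q^ : ∀ e → ¬ n ℕ∣.∣ e → DividesInteger (1# - q ^^ e)
    dividesInteger-1-q^ e n∤e = dividesInteger-1-^^ q n e w {{w≢0}} q^n≈1
      (Φ-multiple (Φ-∣-geometricSum product cancel 1≤d d<n w n≡w*d))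
      where
      open ℕ∣._∣_ (gcd[m,n]∣n e n) renaming (quotient to w; equality to n≡w*d)
      d : ℕ
      d = gcd e n
      n≢0 : ¬ n ≡ 0
      n≢0 n≡0 = ℕₚ.<⇒≢ 1≤n (≡.sym n≡0)
      w≢0 : ℕ.NonZero w
      w≢0 = ℕ.≢-nonZero λ w≡0 → n≢0 (≡.trans n≡w*d (≡.cong (ℕ._* d) w≡0))
      1≤d : 1 ℕ.≤ d
      1≤d = ℕₚ.n≢0⇒n>0 λ d≡0 → n≢0 (gcd[m,n]≡0⇒n≡0 e d≡0)
      d<n : d ℕ.< n
      d<n = ℕₚ.≤∧≢⇒< (ℕ∣.∣⇒≤ {{ℕ.>-nonZero 1≤n}} (gcd[m,n]∣n e n))
        λ d≡n → n∤e (≡.subst (ℕ∣._∣ e) d≡n (gcd[m,n]∣m e n))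

    -- At a = 1 the factor F(x) becomes (1 - x)²(1 - x²) with x = q^(2j+2). The condition on the
    -- doubled exponent implies the one on the exponent itself.
    dividesInteger-evens : ∀ m → (∀ j → j ℕ.< m → ¬ n ℕ∣.∣ 2 ℕ.* (2 ℕ.* j ℕ.+ 2)) →
      DividesInteger (∏ m evens)
    dividesInteger-evens m n∤ = dividesInteger-∏ m evens λ j j<m →
      dividesInteger-cong (S.sym (factors j))
        (dividesInteger-* (dividesInteger-* (dividesInteger-* (linear j j<m) (linear j j<m))
          (dividesInteger-1-q^ (2 ℕ.* (2 ℕ.* j ℕ.+ 2)) (n∤ j j<m))) dividesInteger-1)
      where
      linear : ∀ j → j ℕ.< m → DividesInteger (1# - q ^^ (2 ℕ.* j ℕ.+ 2))
      linear j j<m = dividesInteger-1-q^ (2 ℕ.* j ℕ.+ 2) λ n∣ → n∤ j j<m (ℕ∣.∣n⇒∣m*n 2 n∣)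
      squared : ∀ j → q ^^ (2 ℕ.* j ℕ.+ 2) * q ^^ (2 ℕ.* j ℕ.+ 2) ≈ q ^^ (2 ℕ.* (2 ℕ.* j ℕ.+ 2))
      squared j = trans (sym (^^-+ q (2 ℕ.* j ℕ.+ 2) (2 ℕ.* j ℕ.+ 2)))
        (^^-≡ q (double (2 ℕ.* j ℕ.+ 2)))
        where
        double : ∀ e → e ℕ.+ e ≡ 2 ℕ.* e
        double = solve-∀
      factors : ∀ j → evens j S.≈ (1# - q ^^ (2 ℕ.* j ℕ.+ 2)) * (1# - q ^^ (2 ℕ.* j ℕ.+ 2)) *
        (1# - q ^^ (2 ℕ.* (2 ℕ.* j ℕ.+ 2))) * 1#
      factors j = S.*-cong (S.*-cong (S.*-cong
        (S.+-congˡ (S.-‿cong (S.trans (S.*-congʳ a≈1) (S.*-identityˡ _)))) (S.+-congʳ a≈1))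
        (S.+-congˡ (S.-‿cong (embed (squared j))))) a≈1

    -- Unpacked from `S`, the integer is a combination of x, Φ n and a - 1. A common divisor g
    -- absorbs the first two terms, and the third dies under a ↦ 1.
    commonDivisor : ∀ {x} → DividesInteger x → ∃ λ m → ℕ.NonZero m × ∃ λ w →
      ∀ {g s t} → x ≈ g * s → Φ n ≈ g * t → ∃ λ r → nat m ≈ g * r + (a - 1#) * w
    commonDivisor {x} (dividesInteger m u (w Mod[Φ,a-1]., (v ModΦ., m≈))) =
      m , ℕ.≢-nonZero (ℕ.≢-nonZero⁻¹ m) , w , λ {g} {s} {t} x≈gs Φ≈gt → s * u + t * v ,
      trans m≈ (trans (+-cong (+-congʳ (trans (*-congʳ x≈gs) (*-assoc g s u)))
        (trans (*-congʳ Φ≈gt) (*-assoc g t v)))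
        (solve 4 (λ g x y z → g :* x :+ z :+ g :* y := g :* (x :+ y) :+ z) refl
          g (s * u) (t * v) ((a - 1#) * w)))

    q^n-1≈0⇒Φ∣ : ∀ {x y} → x ≈ 0# + (q ^^ n - 1#) * y → ∃ λ z → x ≈ Φ n * z
    q^n-1≈0⇒Φ∣ {x} {y} x≈ = ∏ n (factor n) * y , trans x≈ (trans (+-identityˡ _)
      (trans (*-congʳ (Φ-cofactor product n 1≤n)) (*-assoc _ _ _)))

-- Cross-multiplication identities

module CrossMultiplication {c ℓ} (R : CommutativeRing c ℓ) where
  open CommutativeRing R hiding (zero)
  open IntegerCoefficients R
  open import Relation.Binary.Reasoning.Setoid setoid

  cross-* : ∀ n d x y m e z w → n * y ≈ x * d → m * w ≈ z * e →
    (n * m) * (y * w) ≈ (x * z) * (d * e)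
  cross-* n d x y m e z w ny≈xd mw≈ze = begin
    (n * m) * (y * w)
      ≈⟨ solve 4 (λ n m y w → (n :* m) :* (y :* w) := (n :* y) :* (m :* w)) refl n m y w ⟩
    (n * y) * (m * w)
      ≈⟨ *-cong ny≈xd mw≈ze ⟩
    (x * d) * (z * e)
      ≈⟨ solve 4 (λ x d z e → (x :* d) :* (z :* e) := (x :* z) :* (d :* e)) refl x d z e ⟩
    (x * z) * (d * e) ∎

  cross-+ : ∀ n d x y m e z → n * y ≈ x * d → m * y ≈ z * e →
    (n * e + m * d) * y ≈ (x + z) * (d * e)
  cross-+ n d x y m e z ny≈xd my≈ze = begin
    (n * e + m * d) * y
      ≈⟨ solve 5 (λ n e m d y → (n :* e :+ m :* d) :* y := (n :* y) :* e :+ (m :* y) :* d) refl n e m d y ⟩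
    (n * y) * e + (m * y) * d
      ≈⟨ +-cong (*-congʳ ny≈xd) (*-congʳ my≈ze) ⟩
    (x * d) * e + (z * e) * d
      ≈⟨ solve 4 (λ x d z e → (x :* d) :* e :+ (z :* e) :* d := (x :+ z) :* (d :* e)) refl x d z e ⟩
    (x + z) * (d * e) ∎

  cross-1- : ∀ n d x y → n * y ≈ x * d → (1# * d + (- n) * 1#) * y ≈ (y - x) * (1# * d)
  cross-1- n d x y ny≈xd = begin
    (1# * d + (- n) * 1#) * y
      ≈⟨ solve 3 (λ n d y → (:1 :* d :+ (:- n) :* :1) :* y := y :* d :- n :* y) refl n d y ⟩
    y * d - n * y
      ≈⟨ +-congˡ (-‿cong ny≈xd) ⟩
    y * d - x * d
      ≈⟨ solve 3 (λ x y d → y :* d :- x :* d := (y :- x) :* (:1 :* d)) refl x y d ⟩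
    (y - x) * (1# * d) ∎

  cross-scale : ∀ {n d x y x′ y′ z} → n * y ≈ x * d → x * z ≈ x′ → y * z ≈ y′ → n * y′ ≈ x′ * d
  cross-scale {n} {d} {x} {y} {x′} {y′} {z} ny≈xd xz≈x′ yz≈y′ = begin
    n * y′          ≈⟨ *-congˡ (sym yz≈y′) ⟩
    n * (y * z)     ≈⟨ sym (*-assoc n y z) ⟩
    (n * y) * z     ≈⟨ *-congʳ ny≈xd ⟩
    (x * d) * z     ≈⟨ solve 3 (λ x d z → (x :* d) :* z := (x :* z) :* d) refl x d z ⟩
    (x * z) * d     ≈⟨ *-congʳ xz≈x′ ⟩
    x′ * d          ∎

  cross-0 : ∀ n d x y → n * y ≈ x * d → (n * 1# + (- 0#) * d) * y ≈ x * (d * 1#)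
  cross-0 n d x y ny≈xd = begin
    (n * 1# + (- 0#) * d) * y
      ≈⟨ solve 3 (λ n d y → (n :* :1 :+ (:- con (0 , 0)) :* d) :* y := n :* y) refl n d y ⟩
    n * y           ≈⟨ ny≈xd ⟩
    x * d           ≈⟨ *-congˡ (sym (*-identityʳ d)) ⟩
    x * (d * 1#)    ∎

-- The ring ℤ[q,a] and its specialisations

open import Defs

ℤ-isDomain : IsDomain ℤR
ℤ-isDomain = record
  { _≈_ = _≡_
  ; isCommutativeRing = ℤₚ.+-*-isCommutativeRing
  ; isZero⇒≈0 = id
  ; ≈0⇒isZero = id
  ; isZero? = ℤ._≟ ℤ.+ 0
  ; nontrivial = λ ()
  ; noZeroDivisors = λ {x} x≢0 y≢0 xy≡0 → [ x≢0 , y≢0 ]′ (ℤₚ.i*j≡0⇒i≡0∨j≡0 x xy≡0)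
  }

module ℤ[q] = Polynomials ℤ-isDomain
module ℤ[q,a] = Polynomials ℤ[q].isDomainₚ

ℤ-ring ℤ[q]-ring Pol-ring : CommutativeRing _ _
ℤ-ring = IsDomain.commutativeRing ℤ-isDomain
ℤ[q]-ring = IsDomain.commutativeRing ℤ[q].isDomainₚ
Pol-ring = IsDomain.commutativeRing ℤ[q,a].isDomainₚ

module Qr = CommutativeRing ℤ[q]-ring
module Pr = CommutativeRing Pol-ring
open ℤ[q,a] using () renaming (_≈ₚ_ to _≃_)
open IsDomain ℤ[q,a].isDomainₚ using (isZero-difference⇒≈; ≈⇒isZero-difference; *-cancelˡ-≉0)

module ℤF = RingFolds ℤ-ring
module QF = RingFolds ℤ[q]-ring
module Cross = CrossMultiplication Pol-ring
open RingFolds Pol-ring using (∏; ∑; _^^_; nat; module Product)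
open Summands Pol-ring q a using (odds; evens; evensTail; T; numerators; denominators)

prodP≡∏ : ∀ n f → prodP n f ≡ ∏ n f
prodP≡∏ zero f = ≡.refl
prodP≡∏ (suc n) f = ≡.cong (_* f n) (prodP≡∏ n f)

^≃^^ : ∀ x n → x ^ n ≃ x ^^ n
^≃^^ x zero = Pr.refl
^≃^^ x (suc n) = Pr.trans (Pr.*-comm x (x ^ n)) (Pr.*-congʳ (^≃^^ x n))

-- The substitutions a ↦ 1 and then q ↦ 0.
at₁ : Pol → List ℤ
at₁ = ℤ[q,a].eval Qr.1#

at₀₁ : Pol → ℤ
at₀₁ x = ℤ[q].eval (ℤ.+ 0) (at₁ x)

at₁-nat : ∀ n → at₁ (nat n) Qr.≈ (ℤ.+ n ∷ [])
at₁-nat n = Qr.trans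
  (Qr.trans (FoldHomomorphism.fold-homo Qr.+-commutativeMonoid at₁
      (ℤ[q,a].eval-+ Qr.1#) Qr.refl n (λ _ → 1#))
    (QF.Sum.fold-cong n λ _ _ → ℤ[q,a].eval-1 Qr.1#))
  (Qr.trans (Qr.sym (FoldHomomorphism.fold-homo Qr.+-commutativeMonoid (_∷ [])
      ℤ[q].const-+ ℤ[q].shift-[] n (λ _ → ℤ.+ 1)))
    (ℤ[q].const-cong (nat≡ n)))
  where
  nat≡ : ∀ n → ℤF.nat n ≡ ℤ.+ n
  nat≡ zero = ≡.refl
  nat≡ (suc n) = ≡.trans (≡.cong (ℤ._+ ℤ.+ 1) (nat≡ n)) (≡.cong ℤ.+_ (ℕₚ.+-comm n 1))

q′ : List ℤ
q′ = ℤ.+ 0 ∷ ℤ.+ 1 ∷ []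

unityPoly : ℕ → List ℤ
unityPoly n = q′ QF.^^ n Qr.- Qr.1#

q^n-1-const : ∀ n → ((q ^^ n) - 1#) ≃ (unityPoly n ∷ [])
q^n-1-const n = Pr.+-congʳ {x = - 1#} (Pr.sym (FoldHomomorphism.fold-homo Pr.*-commutativeMonoid (_∷ [])
  ℤ[q,a].const-* Pr.refl n (λ _ → q′)))

q′^n-1-at-0 : ∀ n → 1 ℕ.≤ n → ℤ[q].eval (ℤ.+ 0) (unityPoly n) ≡ ℤ.- (ℤ.+ 1)
q′^n-1-at-0 (suc n) _ = ≡.trans (ℤ[q].eval-+ (ℤ.+ 0) (q′ QF.^^ suc n) (Qr.- Qr.1#))
  (≡.cong (ℤ._+ ℤ.- (ℤ.+ 1)) (≡.trans (ℤ[q].eval-* (ℤ.+ 0) (q′ QF.^^ n) q′)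
    (ℤₚ.*-zeroʳ (ℤ[q].eval (ℤ.+ 0) (q′ QF.^^ n)))))

-- The value -1 at q = 0 separates the polynomial from 0.
q′^n-1≉0 : ∀ n → 1 ℕ.≤ n → ¬ unityPoly n Qr.≈ []
q′^n-1≉0 n 1≤n eq with ≡.trans (≡.sym (q′^n-1-at-0 n 1≤n)) (ℤ[q].eval-cong (ℤ.+ 0) eq)
... | ()

at₁-q^n-1 : ∀ n → at₁ ((q ^^ n) - 1#) Qr.≈ unityPoly n
at₁-q^n-1 n = Qr.trans (ℤ[q,a].eval-cong Qr.1# (q^n-1-const n)) (ℤ[q,a].eval-const Qr.1# _)

q^d-1-cancel : ∀ d → 1 ℕ.≤ d → ∀ {x y} → (((q ^^ d) - 1#) * x) ≃ (((q ^^ d) - 1#) * y) → x ≃ y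
q^d-1-cancel d 1≤d = *-cancelˡ-≉0 {(q ^^ d) - 1#} λ eq →
  q′^n-1≉0 d 1≤d (Qr.trans (Qr.sym (at₁-q^n-1 d)) (ℤ[q,a].eval-cong Qr.1# eq))

-- A divisor of q ^ n - 1 has degree 0 in a; if after a ↦ 1 it also divides a
-- nonzero integer, then it is an integer, and q ↦ 0 shows that it divides -1.
unit-criterion : ∀ n → 1 ℕ.≤ n → ∀ {g h s c} → .{{_ : ℕ.NonZero c}} →
  ((q ^^ n) - 1#) ≃ (g * h) → (ℤ.+ c ∷ []) Qr.≈ (at₁ g Qr.* s) → ∃ λ k → 1# ≃ (g * k)
unit-criterion n 1≤n {g} {h} {s} {c} q^n-1≃gh c≈gs
  with ℤ[q,a].factor-const (Pr.trans (Pr.sym q^n-1≃gh) (q^n-1-const n)) (q′^n-1≉0 n 1≤n)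
... | g₀ , g≃g₀ with ℤ[q].factor-const (Qr.sym c≈gs) (ℕ.≢-nonZero⁻¹ c ∘ ℤₚ.+-injective)
...   | y , g₁≈y = (ℤ.- z ∷ []) ∷ [] , Pr.sym (Pr.trans (Pr.*-congʳ g≃y) (Pr.trans
          (Pr.sym (ℤ[q,a].const-* (y ∷ []) (ℤ.- z ∷ [])))
          (ℤ[q,a].const-cong (Qr.trans (Qr.sym (ℤ[q].const-* y (ℤ.- z))) (ℤ[q].const-cong y*-z≡1)))))
  where
  z : ℤ
  z = at₀₁ h
  g≃y : g ≃ ((y ∷ []) ∷ [])
  g≃y = Pr.trans g≃g₀ (ℤ[q,a].const-cong (Qr.trans (Qr.sym (Qr.trans
    (ℤ[q,a].eval-cong Qr.1# g≃g₀) (ℤ[q,a].eval-const Qr.1# g₀))) g₁≈y))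
  y*z≡-1 : y ℤ.* z ≡ ℤ.- (ℤ.+ 1)
  y*z≡-1 = ≡.trans
    (≡.cong (ℤ._* z) (≡.sym (≡.trans (ℤ[q].eval-cong (ℤ.+ 0) g₁≈y) (ℤ[q].eval-const (ℤ.+ 0) y))))
    (≡.trans (≡.sym (ℤ[q].eval-* (ℤ.+ 0) (at₁ g) (at₁ h)))
      (≡.trans (ℤ[q].eval-cong (ℤ.+ 0) (Qr.trans (Qr.sym (ℤ[q,a].eval-* Qr.1# g h))
          (Qr.trans (ℤ[q,a].eval-cong Qr.1# (Pr.sym q^n-1≃gh)) (at₁-q^n-1 n))))
        (q′^n-1-at-0 n 1≤n)))
  y*-z≡1 : y ℤ.* (ℤ.- z) ≡ ℤ.+ 1
  y*-z≡1 = ≡.trans (≡.sym (ℤₚ.neg-distribʳ-* y z)) (≡.cong ℤ.-_ y*z≡-1)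

-- Explicit numerators and denominators of the formal fractions

infix 4 _represents_/_
-- The relation is followed through each operation and never composed with itself, since
-- transitivity of cross-multiplication would require cancelling denominators.
record _represents_/_ (f : Frac) (x y : Pol) : Set where
  constructor cross
  field crossEquation : (num f * y) ≃ (x * den f)
open _represents_/_

rep-cong : ∀ {f x y x′ y′} → x ≃ x′ → y ≃ y′ → f represents x / y → f represents x′ / y′
rep-cong {f} x≃x′ y≃y′ (cross eq) = cross (Pr.trans (Pr.*-congˡ {num f} (Pr.sym y≃y′))
  (Pr.trans eq (Pr.*-congʳ {den f} x≃x′)))

rep-emb : ∀ x → emb x represents x / 1#
rep-emb x = cross Pr.refl

rep-* : ∀ {f g x y z w} → f represents x / y → g represents z / w →
  (f *ᶠ g) represents (x * z) / (y * w)
rep-* {f} {g} {x} {y} {z} {w} (cross e₁) (cross e₂) =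
  cross (Cross.cross-* (num f) (den f) x y (num g) (den g) z w e₁ e₂)

rep-/ : ∀ {f g x y z w} → f represents x / y → g represents z / w →
  (f /ᶠ g) represents (x * w) / (y * z)
rep-/ {f} {g} {x} {y} {z} {w} (cross e₁) (cross e₂) =
  cross (Cross.cross-* (num f) (den f) x y (den g) (num g) w z e₁
    (Pr.trans (Pr.*-comm (den g) z) (Pr.trans (Pr.sym e₂) (Pr.*-comm (num g) w))))

rep-1- : ∀ {f x y} → f represents x / y → (f1 -ᶠ f) represents (y - x) / y
rep-1- {f} {x} {y} (cross eq) = cross (Cross.cross-1- (num f) (den f) x y eq)

rep-prodF : ∀ k {f x y} → (∀ j → f j represents x j / y j) → prodF k f represents ∏ k x / ∏ k y
rep-prodF zero reps = rep-emb 1#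
rep-prodF (suc k) reps = rep-* (rep-prodF k reps) (reps k)

-- The single y is the common denominator. The bound on j is there because only summands with index
-- at most m can be extended to `∏ m evens`.
rep-sumF : ∀ k {f x y} → (∀ j → j ℕ.< k → f j represents x j / y) → sumF k f represents ∑ k x / y
rep-sumF zero reps = cross Pr.refl
rep-sumF (suc k) {f} {x} {y} reps = cross (Cross.cross-+ (num (sumF k f)) (den (sumF k f)) (∑ k x) y
  (num (f k)) (den (f k)) (x k)
  (crossEquation (rep-sumF k λ j j<k → reps j (ℕₚ.m<n⇒m<1+n j<k)))
  (crossEquation (reps k ℕₚ.≤-refl)))

rep-^ : ∀ {f x} n → f represents x / 1# → (f ^ᶠ n) represents (x ^^ n) / 1#
rep-^ zero rep = rep-emb 1#
rep-^ {f} {x} (suc n) rep =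
  rep-cong (Pr.*-comm x (x ^^ n)) (Pr.*-identityʳ 1#) (rep-* rep (rep-^ n rep))

rep-poch : ∀ {f p x y r} k → f represents x / y → p represents r / 1# →
  poch f p k represents ∏ k (λ j → y - (x * (r ^^ j))) / ∏ k (λ _ → y)
rep-poch {f} {p} {x} {y} {r} k rep-f rep-p = rep-prodF k λ j →
  rep-1- (rep-cong Pr.refl (Pr.*-identityʳ y) (rep-* rep-f (rep-^ j rep-p)))

rep-poch₁ : ∀ {f p x r} k → f represents x / 1# → p represents r / 1# →
  poch f p k represents ∏ k (λ j → 1# - (x * (r ^^ j))) / 1#
rep-poch₁ k rep-f rep-p = rep-cong Pr.refl (Product.fold-ε k) (rep-poch k rep-f rep-p)

rep-scale : ∀ {f x y x′ y′ z} → f represents x / y → (x * z) ≃ x′ → (y * z) ≃ y′ → f represents x′ / y′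
rep-scale {f} {x} {y} {x′} {y′} {z} (cross eq) xz≃x′ yz≃y′ =
  cross (Cross.cross-scale {num f} {den f} {x} {y} {x′} {y′} {z} eq xz≃x′ yz≃y′)

rep-q^ : ∀ n → (qF ^ᶠ n) represents q ^^ n / 1#
rep-q^ n = rep-^ n (rep-emb q)

rep-term : ∀ k → term k represents (q ^^ (2 ℕ.* k)) * ∏ k odds / ∏ k evens
rep-term k = rep-cong (numerators k) (denominators k) (rep-/
  (rep-* (rep-* (rep-* (rep-poch₁ k (rep-emb-* (rep-emb q)) (rep-q^ 2))
      (rep-poch k (rep-emb-/ (rep-emb q)) (rep-q^ 2)))
    (rep-poch₁ k (rep-q^ 2) (rep-q^ 4))) (rep-q^ (2 ℕ.* k)))
  (rep-* (rep-* (rep-poch₁ k (rep-emb-* (rep-q^ 2)) (rep-q^ 2))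
      (rep-poch k (rep-emb-/ (rep-q^ 2)) (rep-q^ 2)))
    (rep-poch₁ k (rep-q^ 4) (rep-q^ 4))))
  where
  rep-emb-* : ∀ {f x} → f represents x / 1# → (aF *ᶠ f) represents a * x / 1#
  rep-emb-* rep = rep-cong Pr.refl (Pr.*-identityʳ 1#) (rep-* (rep-emb a) rep)
  rep-emb-/ : ∀ {f x} → f represents x / 1# → (f /ᶠ aF) represents x / a
  rep-emb-/ {x = x} rep = rep-cong (Pr.*-identityʳ x) (Pr.*-identityˡ a) (rep-/ rep (rep-emb a))

rep-T : ∀ m k → k ℕ.≤ m → term k represents T k (m ∸ k) / ∏ m evens
rep-T m k k≤m = rep-scale {z = evensTail k (m ∸ k)} (rep-term k) Pr.refl
  (Pr.trans (Product.fold-reverseTail k (m ∸ k) evens)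
    (Pr.reflexive (≡.cong (λ i → ∏ i evens) (ℕₚ.m+[n∸m]≡n k≤m))))

-- The witness D is `∏ m evens`, for which coprimality is available, and not the much larger formal
-- denominator of the sum.
sum-congruence : ∀ m {x P} → sumF (suc m) term represents x / ∏ m evens →
  Coprime (∏ m evens) P → (∃ λ y → x ≃ (P * y)) → sumF (suc m) term ≡ emb 0# [mod P ]
sum-congruence m {x} (cross eq) coprime (y , x≃Py) = x , ∏ m evens ,
  ≈⇒isZero-difference
    (Cross.cross-0 (num (sumF (suc m) term)) (den (sumF (suc m) term)) x (∏ m evens) eq) ,
  coprime , y , ≈⇒isZero-difference x≃Py

-- Coprimality with Φ_n

module _ (Φ : ℕ → Pol) (Φ-cyclotomic : IsCyclotomic Φ) where
  open CyclotomicFactors Pol-ring q Φ using (factor; Φ-cofactor)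

  ∏-factor : ∀ n → 1 ℕ.≤ n → ∏ (suc n) (factor n) ≃ ((q ^^ n) - 1#)
  ∏-factor n 1≤n = Pr.trans (Pr.reflexive (≡.sym (prodP≡∏ (suc n) (factor n))))
    (Pr.trans (isZero-difference⇒≈ (Φ-cyclotomic n 1≤n)) (Pr.+-congʳ {x = - 1#} (^≃^^ q n)))

  module _ (n : ℕ) (1≤n : 1 ℕ.≤ n) where
    open CyclotomicModulus Pol-ring q a Φ using (module Mod)
    open Mod ∏-factor q^d-1-cancel n 1≤n using (S; dividesInteger-evens; commonDivisor; q^n-1≈0⇒Φ∣)
    open DivisorsOfIntegers S using (DividesInteger)

    -- A common divisor g divides q^n - 1 through Φ n, and after a ↦ 1 it divides the nonzero
    -- integer c; these are the two hypotheses of `unit-criterion`.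
    coprime-Φ : ∀ {x} → DividesInteger x → Coprime x (Φ n)
    coprime-Φ {x} x∣ g (s , x≈gs) (t , Φ≈gt) with commonDivisor {x} x∣
    ... | c , c≢0 , w , bezout = proj₁ unit , ≈⇒isZero-difference (proj₂ unit)
      where
      Φ≃gt : Φ n ≃ (g * t)
      Φ≃gt = isZero-difference⇒≈ Φ≈gt
      r : Pol
      r = proj₁ (bezout {g} {s} {t} (isZero-difference⇒≈ x≈gs) Φ≃gt)
      c≃ : nat c ≃ ((g * r) + ((a - 1#) * w))
      c≃ = proj₂ (bezout {g} {s} {t} (isZero-difference⇒≈ x≈gs) Φ≃gt)
      [a-1]w≈0 : at₁ ((a - 1#) * w) Qr.≈ []
      [a-1]w≈0 = Qr.trans (ℤ[q,a].eval-* Qr.1# (a - 1#) w)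
        (Qr.trans (Qr.*-congʳ {at₁ w} (ℤ[q].isZero⇒≈[] (≡.refl ∷ []))) (Qr.zeroˡ (at₁ w)))
      c≈gr : (ℤ.+ c ∷ []) Qr.≈ (at₁ g Qr.* at₁ r)
      c≈gr = Qr.trans (Qr.sym (at₁-nat c)) (Qr.trans (ℤ[q,a].eval-cong Qr.1# c≃)
        (Qr.trans (ℤ[q,a].eval-+ Qr.1# (g * r) ((a - 1#) * w))
          (Qr.trans (Qr.+-cong (ℤ[q,a].eval-* Qr.1# g r) [a-1]w≈0) (Qr.+-identityʳ _))))
      unit : ∃ λ k → 1# ≃ (g * k)
      unit = unit-criterion n 1≤n {g} {t * ∏ n (factor n)} {{c≢0}}
        (Pr.trans (Φ-cofactor ∏-factor n 1≤n) (Pr.trans (Pr.*-congʳ {∏ n (factor n)} Φ≃gt)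
          (Pr.*-assoc g t (∏ n (factor n))))) c≈gr

-- The congruence for n = 4t + 3

module _ (t : ℕ) where
  private
    m n : ℕ
    m = suc (t ℕ.+ t)
    n = 2 ℕ.* m ℕ.+ 1

  -- Since n is odd, it would have to divide 2j + 2, which is positive and at most 2m = n - 1.
  ∤-exponents : ∀ j → j ℕ.< m → ¬ n ℕ∣.∣ 2 ℕ.* (2 ℕ.* j ℕ.+ 2)
  ∤-exponents j j<m n∣ =
    ℕₚ.<⇒≱ 2j+2<n (ℕ∣.∣⇒≤ {{ℕ.>-nonZero 0<2j+2}} (coprime-divisor (odd-coprime m) n∣))
    where
    0<2j+2 : 0 ℕ.< 2 ℕ.* j ℕ.+ 2
    0<2j+2 = ℕₚ.<-≤-trans (ℕ.s≤s ℕ.z≤n) (ℕₚ.m≤n+m 2 (2 ℕ.* j))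
    odd-coprime : ∀ m → Coprimeℕ (2 ℕ.* m ℕ.+ 1) 2
    odd-coprime m {i} (i∣n , i∣2) = ℕ∣.∣1⇒≡1 (ℕ∣.∣m+n∣m⇒∣n i∣n (ℕ∣.∣m⇒∣m*n m i∣2))
    2j+2<n : 2 ℕ.* j ℕ.+ 2 ℕ.< n
    2j+2<n = ℕₚ.≤-trans (ℕₚ.≤-reflexive (double j)) (ℕₚ.+-monoˡ-≤ 1 (ℕₚ.*-monoʳ-≤ 2 j<m))
      where
      double : ∀ j → suc (2 ℕ.* j ℕ.+ 2) ≡ 2 ℕ.* suc j ℕ.+ 1
      double = solve-∀

  theorem-odd : (Φ : ℕ → Pol) → IsCyclotomic Φ → sumF (suc m) term ≡ emb 0# [mod Φ n ]
  theorem-odd Φ Φ-cyclotomic = sum-congruence m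
    (rep-sumF (suc m) λ { k (ℕ.s≤s k≤m) → rep-T m k k≤m })
    (coprime-Φ Φ Φ-cyclotomic n 1≤n (dividesInteger-evens m ∤-exponents))
    (q^n-1≈0⇒Φ∣ {y = multiplier} equation)
    where
    1≤n : 1 ℕ.≤ n
    1≤n = ℕₚ.m≤n+m 1 (2 ℕ.* m)
    open CyclotomicModulus Pol-ring q a Φ using (module Mod)
    open Mod (∏-factor Φ Φ-cyclotomic) q^d-1-cancel n 1≤n using (dividesInteger-evens; q^n-1≈0⇒Φ∣)
    open Quotient Pol-ring ((q ^^ n) - 1#)
    q^n≈1 : (q ^^ n) ≈/ 1#
    q^n≈1 = x≈1+[x-1] (q ^^ n) Pr.refl
    -- The sum of the `T` in the quotient is convertible with the one over `Pol-ring`, so the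
    -- multiplier exhibits the polynomial numerator as a multiple of q^n - 1.
    open _≈/_ (Summands.∑-T≈0 quotientRing q a m q^n≈1 t ≡.refl)

theorem3p2 : (Φ : ℕ → Pol) → IsCyclotomic Φ → (n : ℕ) → n % 4 ≡ 3 →
    sumF (suc ((n ∸ 1) / 2)) term ≡ emb 0# [mod Φ n ]
theorem3p2 Φ Φ-cyclotomic n n%4≡3 = ≡.subst
  (λ n → sumF (suc ((n ∸ 1) / 2)) term ≡ emb 0# [mod Φ n ])
  (≡.sym n≡) (≡.subst (λ m → sumF (suc m) term ≡ emb 0# [mod Φ (2 ℕ.* suc (t ℕ.+ t) ℕ.+ 1) ])
    (≡.sym half) (theorem-odd t Φ Φ-cyclotomic))
  where
  -- From n = 4t + 3 it follows that m = (n - 1) / 2 = 2t + 1 is odd.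
  t : ℕ
  t = n / 4
  n≡ : n ≡ 2 ℕ.* suc (t ℕ.+ t) ℕ.+ 1
  n≡ = ≡.trans (m≡m%n+[m/n]*n n 4) (≡.trans (≡.cong (ℕ._+ t ℕ.* 4) n%4≡3) (regroup t))
    where
    regroup : ∀ t → 3 ℕ.+ t ℕ.* 4 ≡ 2 ℕ.* suc (t ℕ.+ t) ℕ.+ 1
    regroup = solve-∀
  half : (2 ℕ.* suc (t ℕ.+ t) ℕ.+ 1 ∸ 1) / 2 ≡ suc (t ℕ.+ t)
  half = ≡.trans
    (≡.cong (_/ 2) (≡.trans (ℕₚ.m+n∸n≡m (2 ℕ.* suc (t ℕ.+ t)) 1) (ℕₚ.*-comm 2 (suc (t ℕ.+ t)))))
    (m*n/n≡m (suc (t ℕ.+ t)) 2)
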